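{- For every $r\ge0$ and $0\le i\le r$ there is a bijection $$\Phi:\mathcal{U}^i_{\mathrm{Car}_{r+3}}(1,1,\ldots,1)\longrightarrow\mathcal{M}(r,i)$$ from the set of level-$i$ refined unified diagrams of the caracol graph to the set of multi-labeled Dyck paths. Hence, with $T(r,i)=\big|\mathcal{U}^i_{\mathrm{Car}_{r+3}}(1,1,\ldots,1)\big|$, one has $|\mathcal{M}(r,i)|=T(r,i)$ for $0\le i\le r$.
   Context: Put $n=r+2$. The caracol graph $\mathrm{Car}_{n+1}=\mathrm{Car}_{r+3}$ is the directed graph on $\{1,\ldots,n+1\}$ with edges $(1,j)$ for $2\le j\le n$, $(i,i+1)$ for $2\le i\le n$, and $(i,n+1)$ for $2\le i\le n-1$. Its shifted out-degree vector (entries: out-degree of $i$ minus $1$, for $i=1,\ldots,n$) is $\mathbf{t}=(r,1,\ldots,1,0)$, with $|\mathbf{t}|=2r$. Its restriction $(\mathrm{Car}_{n+1})|_n$ to the vertices $1,\ldots,n$ has edges $(1,j)$, $2\le j\le n$, and $(i,i+1)$, $2\le i\le n-1$. A $\mathbf{t}$-Dyck path is a sequence of nonnegative integers $\mathbf{s}=(s_1,\ldots,s_n)$ with sum $|\mathbf{t}|$ and $\sum_{j\le k}s_j\ge\sum_{j\le k}t_j$ for all $k$, identified with the lattice path $N^{s_1}EN^{s_2}E\cdots N^{s_n}E$. Gravity diagrams: for a graph $H$ on $[n]$ (edges directed from smaller to larger vertices) and $\mathbf{v}\in\mathbb{Z}^n$ with entry sum $0$, write $\mathbf{v}=\sum_{k=1}^{n-1}d_k\boldsymbol{\alpha}_k$,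 $\boldsymbol{\alpha}_k=\mathbf{e}_k-\mathbf{e}_{k+1}$. A line-dot diagram is a partition of an array of dots with $d_k$ dots in column $k$ (none exists if some $d_k<0$) into lines, each line assigned to an edge $(p,q)$ of $H$ and consisting of exactly one dot from each of the columns $p,\ldots,q-1$. Two are equivalent if each edge is assigned the same number of lines in both. $\mathcal{GD}_H(\mathbf{v})$ is the set of equivalence classes; equivalently it is the set of ways of writing $\mathbf{v}$ as a nonnegative integer combination of the vectors $\mathbf{e}_p-\mathbf{e}_q$, $(p,q)\in E(H)$. Level-$i$ refined unified diagrams: $\mathcal{U}^i_{\mathrm{Car}_{r+3}}(1,\ldots,1)$ is the set of triples $(\mathbf{s},\sigma,D)$ where $\mathbf{s}$ is a $\mathbf{t}$-Dyck path with $s_1=|\mathbf{t}|-i$, $\sigma$ is a permutation of $[i]$ labeling the $i$ north steps not in the first column, with labels increasing along consecutive north steps in each column, and $D\in\mathcal{GD}_{(\mathrm{Car}_{r+3})|_{r+2}}(\mathbf{s}-\mathbf{t})$. Multi-labeled Dyck paths: $\mathcal{M}(r,i)$ is the set of Dyck paths from $(0,0)$ to $(r,r)$ (north and east unit steps, staying weakly above the diagonal) whose $r$ north steps are labeled by the multiset $\{0^{r-i},1,\ldots,i\}$ ($r-i$ copies of $0$ and one each of $1,\ldots,i$) such that labels on consecutive north steps are non-decreasing. -}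

module Defs where

open import Data.Fin using (Fin; toℕ)
import Data.Integer as ℤ
open ℤ using (ℤ; _⊖_)
open import Data.List using
  (List; []; _∷_; _++_; applyUpTo; drop; filter; foldr; length; lookup; map; mapMaybe; replicate; take)
open import Data.List.Membership.Propositional using (_∈_)
open import Data.List.Relation.Binary.Permutation.Propositional using (_↭_)
open import Data.List.Relation.Unary.All using (All)
open import Data.List.Relation.Unary.Linked using (Linked)
open import Data.Maybe using (Maybe; just; nothing)
open import Data.Nat using (ℕ; zero; suc; _+_; _∸_; _≤_; _<_; _≤?_)
import Data.Nat as ℕ
open import Data.Nat.ListAction using (sum)
open import Data.Product using (_×_; _,_; ∃!)
open import Data.Product.Properties using (≡-dec)
open import Data.Vec using (Vec; head; tail; tabulate; toList; zipWith)
open import Function.Bundles using (Bijection)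
open import Relation.Binary using (Setoid)
import Relation.Binary.Construct.On as On
open import Relation.Binary.PropositionalEquality as ≡ using (_≡_)
open import Relation.Nullary.Decidable using (_×-dec_)
open import Level using (0ℓ)

infix  4 _∼_ _≈ᵁ_ _⊑_
infixl 6 _⊟_
infixl 7 _↾_

-- The integers from a to b inclusive, empty if b < a.
[_⋯_] : ℕ → ℕ → List ℕ
[ a ⋯ b ] = applyUpTo (a +_) (suc b ∸ a)

------------------------------------------------------------------------
-- Directed graphs

-- Vertices are the numbers 1, 2, …; a graph is the list of its edges (p , q).
Edge : Set
Edge = ℕ × ℕ

Graph : Set
Graph = List Edge

_↾_ : Graph → ℕ → Graph
G ↾ m = filter (λ (p , q) → (p ≤? m) ×-dec (q ≤? m)) G

outDegree : Graph → ℕ → ℕ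
outDegree G i = length (filter (λ (p , _) → p ℕ.≟ i) G)

-- Entry i of the vector is the one at position i − 1.  The subtraction is
-- truncated, which is harmless when each of 1, …, n has an outgoing edge.
shiftedOutDegrees : Graph → (n : ℕ) → Vec ℕ n
shiftedOutDegrees G n = tabulate λ i → outDegree G (suc (toℕ i)) ∸ 1

-- Indexed by the number of vertices: Car (suc n) is the graph on 1, …, n + 1.
Car : ℕ → Graph
Car zero    = []
Car (suc n) = map (λ j → 1 , j)     [ 2 ⋯ n ]
           ++ map (λ i → i , suc i) [ 2 ⋯ n ]
           ++ map (λ i → i , suc n) [ 2 ⋯ n ∸ 1 ]

------------------------------------------------------------------------
-- t-Dyck paths

∣_∣ᵥ : ∀ {n} → Vec ℕ n → ℕ
∣ v ∣ᵥ = sum (toList v)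

prefixSum : ∀ {n} → ℕ → Vec ℕ n → ℕ
prefixSum k v = sum (take k (toList v))

record IsDyck {n} (t s : Vec ℕ n) : Set where
  field
    total     : ∣ s ∣ᵥ ≡ ∣ t ∣ᵥ
    dominates : ∀ k → k ≤ n → prefixSum k t ≤ prefixSum k s

------------------------------------------------------------------------
-- Gravity diagrams

_⊟_ : ∀ {n} → Vec ℕ n → Vec ℕ n → Vec ℤ n
_⊟_ = zipWith _⊖_

-- The coefficient d_k of αₖ = eₖ − eₖ₊₁ in a vector v of entry sum 0: comparing
-- entries in v = Σ d_k αₖ gives v₁ = d₁ and vₖ = d_k − d_{k−1}, hence
-- d_k = v₁ + ⋯ + vₖ.
coefficient : ∀ {n} → Vec ℤ n → ℕ → ℤ
coefficient v k = foldr ℤ._+_ ℤ.0ℤ (take k (toList v))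

-- The columns are 1, …, m; column k is represented by k − 1 : Fin m.
column : ∀ {m} → Fin m → ℕ
column k = suc (toℕ k)

-- A line-dot diagram.  The dots of column k are the elements of Fin (dots k);
-- as this is a natural number, there is no diagram when some d_k < 0.
-- The lines are the positions in the list `lines`, which records the edge
-- assigned to each of them, and lineOf partitions the dots into lines.
record LineDotDiagram {m} (H : Graph) (v : Vec ℤ (suc m)) : Set where
  field
    dots      : Fin m → ℕ
    dots-≡    : ∀ k → ℤ.+ dots k ≡ coefficient v (column k)
    lines     : List Edge
    areEdges  : All (_∈ H) lines
    lineOf    : ∀ k → Fin (dots k) → Fin (length lines)
    onlySpan  : ∀ k a → let (p , q) = lookup lines (lineOf k a) in
                p ≤ column k × column k < q
    oneOfEach : ∀ k l → let (p , q) = lookup lines l in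
                p ≤ column k → column k < q → ∃! _≡_ λ a → lineOf k a ≡ l

  multiplicity : Edge → ℕ
  multiplicity e = length (filter (≡-dec ℕ._≟_ ℕ._≟_ e) lines)

open LineDotDiagram using (multiplicity)

-- Equivalence of line-dot diagrams.  Gravity diagrams are line-dot diagrams
-- up to _∼_.  The two vectors may differ syntactically, so that diagrams
-- belonging to different triples (s , σ , D) can be compared.
_∼_ : ∀ {m H} {v w : Vec ℤ (suc m)} → LineDotDiagram H v → LineDotDiagram H w → Set
_∼_ {H = H} D D′ = ∀ e → e ∈ H → multiplicity D e ≡ multiplicity D′ e

------------------------------------------------------------------------
-- Refined unified diagrams of Car_{r+3} with net flow (1, …, 1)

-- Cut a word into consecutive blocks of the given lengths.
blocks : {A : Set} → List ℕ → List A → List (List A)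
blocks []       xs = []
blocks (m ∷ ms) xs = take m xs ∷ blocks ms (drop m xs)

𝐭 : (r : ℕ) → Vec ℕ (2 + r)
𝐭 r = shiftedOutDegrees (Car (3 + r)) (2 + r)

-- σ is a permutation of 1, …, i in one-line notation, listing the labels of the
-- north steps after the first column in the order of the path; the labels of
-- the j-th column (j ≥ 2) are therefore the next sⱼ letters of σ.
record UnifiedDiagram (r i : ℕ) : Set where
  field
    s          : Vec ℕ (2 + r)
    isDyck     : IsDyck (𝐭 r) s
    level      : head s + i ≡ ∣ 𝐭 r ∣ᵥ
    σ          : List ℕ
    isPerm     : σ ↭ [ 1 ⋯ i ]
    increasing : All (Linked _<_) (blocks (toList (tail s)) σ)
    D          : LineDotDiagram (Car (3 + r) ↾ (2 + r)) (s ⊟ 𝐭 r)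

record _≈ᵁ_ {r i} (u u′ : UnifiedDiagram r i) : Set where
  private
    module u  = UnifiedDiagram u
    module u′ = UnifiedDiagram u′
  field
    s≡ : u.s ≡ u′.s
    σ≡ : u.σ ≡ u′.σ
    D∼ : u.D ∼ u′.D

𝒰 : (r i : ℕ) → Setoid 0ℓ 0ℓ
𝒰 r i = record
  { Carrier       = UnifiedDiagram r i
  ; _≈_           = _≈ᵁ_
  ; isEquivalence = record
    { refl  = record { s≡ = ≡.refl ; σ≡ = ≡.refl ; D∼ = λ _ _ → ≡.refl }
    ; sym   = λ x → record
      { s≡ = ≡.sym (s≡ x) ; σ≡ = ≡.sym (σ≡ x) ; D∼ = λ e e∈ → ≡.sym (D∼ x e e∈) }
    ; trans = λ x y → record
      { s≡ = ≡.trans (s≡ x) (s≡ y)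
      ; σ≡ = ≡.trans (σ≡ x) (σ≡ y)
      ; D∼ = λ e e∈ → ≡.trans (D∼ x e e∈) (D∼ y e e∈)
      }
    }
  }
  where open _≈ᵁ_

------------------------------------------------------------------------
-- Multi-labeled Dyck paths

-- A lattice step; north steps carry their label.
data Step : Set where
  N : ℕ → Step
  E : Step

labels : List Step → List ℕ
labels = mapMaybe λ { (N a) → just a ; E → nothing }

#N : List Step → ℕ
#N w = length (labels w)

#E : List Step → ℕ
#E []        = 0
#E (N _ ∷ w) = #E w
#E (E   ∷ w) = suc (#E w)

-- A condition on consecutive steps, vacuous unless both are north steps.
data _⊑_ : Step → Step → Set where
  NN : ∀ {a b} → a ≤ b → N a ⊑ N b
  E- : ∀ {x} → E ⊑ x
  -E : ∀ {x} → x ⊑ E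

record MultiLabeledDyckPath (r i : ℕ) : Set where
  field
    word      : List Step
    norths    : #N word ≡ r
    easts     : #E word ≡ r
    aboveDiag : ∀ k → #E (take k word) ≤ #N (take k word)
    labelled  : labels word ↭ replicate (r ∸ i) 0 ++ [ 1 ⋯ i ]
    nondecr   : Linked _⊑_ word

ℳ : (r i : ℕ) → Setoid 0ℓ 0ℓ
ℳ r i = On.setoid (≡.setoid (List Step)) (MultiLabeledDyckPath.word {r} {i})

------------------------------------------------------------------------
-- Cardinality

HasCardinality : Setoid 0ℓ 0ℓ → ℕ → Set
HasCardinality S n = Bijection S (≡.setoid (Fin n))

{-# OPTIONS --safe #-}
-- A flow on the caracol graph restricted to 1, …, r + 2 is determined by its spokes f_j on
-- (1 , j), for 2 ≤ j ≤ r + 1: the spoke to r + 2 vanishes, and counting the dots of column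
-- k + 1 shows that the rim edge (k + 1 , k + 2) carries (f_2 + s_2) + ⋯ + (f_{k+1} + s_{k+1}) − k
-- lines.  Hence a diagram is the path whose columns consist of f_j north steps labelled 0
-- followed by s_j north steps with the labels of σ, and the nonnegativity of the rim flow says
-- exactly that this path stays above the diagonal.
module Submission where

open import Defs
open import Data.Fin using (Fin; zero; suc; fromℕ<; toℕ)
import Data.Fin.Properties as Fin
import Data.Integer as ℤ
import Data.Integer.Properties as ℤ
open import Data.List using
  (List; []; _∷_; _++_; [_]; allFin; applyUpTo; cartesianProductWith; concat; concatMap;
   deduplicate; drop; filter; length; lookup; map; replicate; tabulate; take; zip)
import Data.List.Membership.DecPropositional as DecMembership
open import Data.List.Membership.Propositional using (_∈_)
open import Data.List.Membership.Propositional.Properties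
open import Data.List.Membership.Propositional.Properties.WithK using (unique∧set⇒bag)
open import Data.List.Properties renaming (≡-dec to List-≡-dec) hiding (sum-++)
open import Data.List.Relation.Binary.BagAndSetEquality using (∼bag⇒↭)
open import Data.List.Relation.Binary.Permutation.Propositional using
  (_↭_; ↭-refl; ↭-sym; ↭-trans; prep; ↭⇒↭ₛ; module PermutationReasoning)
open import Data.List.Relation.Binary.Permutation.Propositional.Properties using
  (All-resp-↭; drop-mid; filter-↭; shift; shifts; ++⁺ˡ; ↭-length; ∈-resp-↭)
import Data.List.Relation.Binary.Permutation.Setoid.Properties as Permutationₛ
open import Data.List.Relation.Unary.All as All using (All; []; _∷_)
import Data.List.Relation.Unary.All.Properties as All
open import Data.List.Relation.Unary.AllPairs using ([]; _∷_)
open import Data.List.Relation.Unary.Any using (here; there; index)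
open import Data.List.Relation.Unary.Any.Properties using (lookup-index)
open import Data.List.Relation.Unary.Linked as Linked using (Linked; []; [-]; _∷_)
import Data.List.Relation.Unary.Unique.DecPropositional.Properties as DecUnique
open import Data.List.Relation.Unary.Unique.Propositional using (Unique)
import Data.List.Relation.Unary.Unique.Propositional.Properties as Unique
open import Data.Nat
open import Data.Nat.ListAction using (sum)
open import Data.Nat.ListAction.Properties using (sum-++)
open import Data.Nat.Properties
open import Data.Nat.Tactic.RingSolver using (solve-∀)
open import Data.Product using (_×_; _,_; ∃; proj₁; proj₂)
open import Data.Product.Properties using (≡-dec)
open import Data.Sum using (inj₁; inj₂)
open import Data.Vec as Vec using (Vec; []; _∷_; fromList; head; tail; toList)
import Data.Vec.Properties as Vec
open import Function using (_∘_; mk⇔)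
open import Function.Bundles using (Bijection)
open import Function.Consequences.Setoid using (strictlySurjective⇒surjective)
import Function.Construct.Composition as Composition
open import Level using (0ℓ)
import Relation.Binary.Construct.On as On
open import Relation.Binary.Definitions using (DecidableEquality; tri<; tri≈; tri>)
open import Relation.Binary.PropositionalEquality hiding ([_])
open import Relation.Nullary using (Dec; ¬_; contradiction; no; yes)
open import Relation.Nullary.Decidable using (map′; _×-dec_)
open import Relation.Unary using (Decidable; Pred)

-- A `LineDotDiagram` carries far more than its class: dots, an order of the lines, an assignment of
-- dots to lines. The dots enter only through the number of lines crossing each column, which is a
-- difference of prefix sums of `s` and `𝐭`. Such identities are stated as equations between sums in
-- ℕ where possible, since truncated subtraction is exact only where the nonnegativity at issue is
-- already known. The two outer entries of `s` leave no trace in the path. The last one is 0 because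
-- `𝐭` has spent its total `r + r` before its last entry; the same fact empties the last column of
-- dots, which is why the spoke to `r + 2` vanishes. The first one is fixed by the level, and its
-- excess over `r` is `r ∸ i`, the number of zeros. Decoding a path is unambiguous: labels do not
-- decrease along a column and the letters of `σ` are positive, so the zeros of a column come before
-- its other labels. As the letters of `σ` are also distinct, weak increase along the path agrees
-- with strict increase in the diagram.

private variable
  A B : Set

-- Counting in lists

count : {P : Pred A 0ℓ} → Decidable P → List A → ℕ
count P? xs = length (filter P? xs)

count-++ : {P : Pred A 0ℓ} (P? : Decidable P) (xs ys : List A) →
           count P? (xs ++ ys) ≡ count P? xs + count P? ys
count-++ P? xs ys =
  trans (cong length (filter-++ P? xs ys)) (length-++ (filter P? xs))

count-all : {P : Pred A 0ℓ} (P? : Decidable P) {xs : List A} → All P xs → count P? xs ≡ length xs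
count-all P? ps = cong length (filter-all P? ps)

count-none : {P : Pred A 0ℓ} (P? : Decidable P) {xs : List A} → All (¬_ ∘ P) xs → count P? xs ≡ 0
count-none P? ps = cong length (filter-none P? ps)

count-map : {P : Pred B 0ℓ} (P? : Decidable P) (f : A → B) (xs : List A) →
            count P? (map f xs) ≡ count (P? ∘ f) xs
count-map P? f []       = refl
count-map P? f (x ∷ xs) with P? (f x)
... | yes _ = cong suc (count-map P? f xs)
... | no  _ = count-map P? f xs

-- `P` is, at the single point `x`, the disjoint union of `Q` and `R`. The constructors list the
-- consistent truth values, so counts add up by induction on the list.
data Splits {A : Set} (P Q R : Pred A 0ℓ) (x : A) : Set where
  neither : ¬ P x → ¬ Q x → ¬ R x → Splits P Q R x
  left    : P x → Q x → ¬ R x → Splits P Q R x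
  right   : P x → ¬ Q x → R x → Splits P Q R x

count-split : {P Q R : Pred A 0ℓ} (P? : Decidable P) (Q? : Decidable Q) (R? : Decidable R)
              {xs : List A} →
              All (Splits P Q R) xs → count P? xs ≡ count Q? xs + count R? xs
count-split P? Q? R? [] = refl
count-split P? Q? R? {x ∷ xs} (neither ¬p ¬q ¬r ∷ ss)
  rewrite filter-reject P? {xs = xs} ¬p | filter-reject Q? {xs = xs} ¬q
          | filter-reject R? {xs = xs} ¬r
  = count-split P? Q? R? ss
count-split P? Q? R? {x ∷ xs} (left p q ¬r ∷ ss)
  rewrite filter-accept P? {xs = xs} p | filter-accept Q? {xs = xs} q
          | filter-reject R? {xs = xs} ¬r
  = cong suc (count-split P? Q? R? ss)
count-split P? Q? R? {x ∷ xs} (right p ¬q r ∷ ss)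
  rewrite filter-accept P? {xs = xs} p | filter-reject Q? {xs = xs} ¬q
          | filter-accept R? {xs = xs} r
  = trans (cong suc (count-split P? Q? R? ss)) (sym (+-suc (count Q? xs) (count R? xs)))

count-≐ : {P Q : Pred A 0ℓ} (P? : Decidable P) (Q? : Decidable Q) {xs : List A} →
          All (λ x → (P x → Q x) × (Q x → P x)) xs → count P? xs ≡ count Q? xs
count-≐ P? Q? [] = refl
count-≐ P? Q? {x ∷ xs} ((to , from) ∷ es) with P? x | Q? x
... | yes _ | yes _ = cong suc (count-≐ P? Q? es)
... | no  _ | no  _ = count-≐ P? Q? es
... | yes p | no ¬q = contradiction (to p) ¬q
... | no ¬p | yes q = contradiction (from q) ¬p

count-mono : {P Q : Pred A 0ℓ} (P? : Decidable P) (Q? : Decidable Q) → (∀ {x} → P x → Q x) →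
             ∀ xs → count P? xs ≤ count Q? xs
count-mono P? Q? P⊆Q []       = z≤n
count-mono P? Q? P⊆Q (x ∷ xs) with P? x | Q? x
... | yes _ | yes _ = s≤s (count-mono P? Q? P⊆Q xs)
... | no  _ | no  _ = count-mono P? Q? P⊆Q xs
... | no  _ | yes _ = m≤n⇒m≤1+n (count-mono P? Q? P⊆Q xs)
... | yes p | no ¬q = contradiction (P⊆Q p) ¬q

count-applyUpTo-one : {P : Pred A 0ℓ} (P? : Decidable P) (f : ℕ → A) {n k : ℕ} → k < n →
                      P (f k) → (∀ j → j ≢ k → ¬ P (f j)) → count P? (applyUpTo f n) ≡ 1
count-applyUpTo-one P? f {suc n} {zero} _ p ¬p =
  trans (cong length (filter-accept P? p))
        (cong suc (count-none P? (All.applyUpTo⁺₂ (f ∘ suc) n (λ j → ¬p (suc j) λ ()))))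
count-applyUpTo-one P? f {suc n} {suc k} (s≤s k<n) p ¬p =
  trans (cong length (filter-reject P? (¬p 0 λ ())))
        (count-applyUpTo-one P? (f ∘ suc) k<n p (λ j j≢k → ¬p (suc j) (j≢k ∘ suc-injective)))

-- This realises a prescribed flow by a list of lines. Uniqueness of `xs` ensures that all copies of
-- `x` stem from one entry.
count-concatMap-replicate : (_≟′_ : (x y : A) → Dec (x ≡ y)) (μ : A → ℕ) {xs : List A} →
  Unique xs → ∀ {x} → x ∈ xs → count (x ≟′_) (concatMap (λ y → replicate (μ y) y) xs) ≡ μ x
count-concatMap-replicate _≟′_ μ {xs = x ∷ xs} (x∉xs ∷ u) (here refl) = begin
  count (x ≟′_) (replicate (μ x) x ++ copies xs)          ≡⟨ count-++ _ (replicate (μ x) x) _ ⟩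
  count (x ≟′_) (replicate (μ x) x) + count (x ≟′_) (copies xs)
    ≡⟨ cong₂ _+_ (count-all _ (All.replicate⁺ (μ x) refl)) (count-none _ (copies-∌ xs x∉xs)) ⟩
  length (replicate (μ x) x) + 0                          ≡⟨ +-identityʳ _ ⟩
  length (replicate (μ x) x)                              ≡⟨ length-replicate (μ x) ⟩
  μ x                                                     ∎
  where
  open ≡-Reasoning
  copies : List _ → List _
  copies = concatMap (λ y → replicate (μ y) y)
  copies-∌ : ∀ ys → All (x ≢_) ys → All (x ≢_) (copies ys)
  copies-∌ []       []         = []
  copies-∌ (y ∷ ys) (x≢y ∷ ps) = All.++⁺ (All.replicate⁺ (μ y) x≢y) (copies-∌ ys ps)
count-concatMap-replicate _≟′_ μ {xs = y ∷ xs} (y∉xs ∷ u) {x} (there x∈xs) =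
  trans (count-++ _ (replicate (μ y) y) _)
        (cong₂ _+_ (count-none _ (All.replicate⁺ (μ y) λ { refl → All.lookup y∉xs x∈xs refl }))
                   (count-concatMap-replicate _≟′_ μ u x∈xs))

concatMap-replicate-⊆ : (μ : A → ℕ) (xs : List A) →
                        All (_∈ xs) (concatMap (λ y → replicate (μ y) y) xs)
concatMap-replicate-⊆ μ []       = []
concatMap-replicate-⊆ μ (x ∷ xs) =
  All.++⁺ (All.replicate⁺ (μ x) (here refl)) (All.map there (concatMap-replicate-⊆ μ xs))

lookup-injective : {xs : List A} → Unique xs → ∀ i j → lookup xs i ≡ lookup xs j → i ≡ j
lookup-injective (_ ∷ _) zero    zero    _  = refl
lookup-injective {xs = x ∷ xs} (x∉ ∷ _) zero (suc j) eq =
  contradiction eq (All.lookup x∉ (∈-lookup {xs = xs} j))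
lookup-injective {xs = x ∷ xs} (x∉ ∷ _) (suc i) zero eq =
  contradiction (sym eq) (All.lookup x∉ (∈-lookup {xs = xs} i))
lookup-injective (_ ∷ u) (suc i) (suc j) eq = cong suc (lookup-injective u i j eq)

-- Positions instead of entries, because several lines of a diagram may be assigned to the same edge
-- and must be kept apart.
positions : {P : Pred A 0ℓ} → Decidable P → (xs : List A) → List (Fin (length xs))
positions P? xs = filter (P? ∘ lookup xs) (allFin (length xs))

length-positions : {P : Pred A 0ℓ} (P? : Decidable P) (xs : List A) →
                   length (positions P? xs) ≡ count P? xs
length-positions P? xs = begin
  count (P? ∘ lookup xs) (allFin (length xs))   ≡⟨ count-map P? (lookup xs) (allFin (length xs)) ⟨
  count P? (map (lookup xs) (allFin (length xs)))
    ≡⟨ cong (count P?) (map-tabulate (λ i → i) (lookup xs)) ⟩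
  count P? (tabulate (lookup xs))     ≡⟨ cong (count P?) (tabulate-lookup xs) ⟩
  count P? xs                                   ∎
  where open ≡-Reasoning

positions-unique : {P : Pred A 0ℓ} (P? : Decidable P) (xs : List A) → Unique (positions P? xs)
positions-unique P? xs = Unique.filter⁺ (P? ∘ lookup xs) (Unique.allFin⁺ (length xs))

-- Lists given by their entries, and their prefix sums

-- The default 0 matters: it is the flow given to the spoke ending at `2 + r`, whose index lies just
-- beyond the list of columns.
nth : List ℕ → ℕ → ℕ
nth []       _       = 0
nth (x ∷ _)  zero    = x
nth (_ ∷ xs) (suc k) = nth xs k

nth-applyUpTo : ∀ xs {n} → length xs ≡ n → applyUpTo (nth xs) n ≡ xs
nth-applyUpTo []       refl = refl
nth-applyUpTo (x ∷ xs) refl = cong (x ∷_) (nth-applyUpTo xs refl)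

nth-beyond : ∀ xs {k} → length xs ≤ k → nth xs k ≡ 0
nth-beyond []       _         = refl
nth-beyond (x ∷ xs) (s≤s len≤) = nth-beyond xs len≤

applyUpTo-cong : {f g : ℕ → A} (n : ℕ) → (∀ k → k < n → f k ≡ g k) → applyUpTo f n ≡ applyUpTo g n
applyUpTo-cong zero    f≗g = refl
applyUpTo-cong (suc n) f≗g = cong₂ _∷_ (f≗g 0 z<s)
  (applyUpTo-cong n λ k k<n → f≗g (suc k) (s<s k<n))

applyUpTo-injective : {f g : ℕ → A} (n : ℕ) → applyUpTo f n ≡ applyUpTo g n →
                      ∀ k → k < n → f k ≡ g k
applyUpTo-injective (suc n) eq zero    _         = ∷-injectiveˡ eq
applyUpTo-injective (suc n) eq (suc k) (s≤s k<n) = applyUpTo-injective n (∷-injectiveʳ eq) k k<n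

sum-take-≤ : ∀ k xs → sum (take k xs) ≤ sum xs
sum-take-≤ zero    xs       = z≤n
sum-take-≤ (suc k) []       = z≤n
sum-take-≤ (suc k) (x ∷ xs) = +-monoʳ-≤ x (sum-take-≤ k xs)

-- Here `a k` stands for a tail sum of `f` starting at `k`, so a prefix and its tail make up the
-- whole without any subtraction.
sum-take-telescope : (f a : ℕ → ℕ) → (∀ k → a k ≡ f k + a (suc k)) →
                     ∀ n k → k ≤ n → sum (take k (applyUpTo f n)) + a k ≡ a 0
sum-take-telescope f a step n       zero    _         = refl
sum-take-telescope f a step (suc n) (suc k) (s≤s k≤n) = begin
  f 0 + sum (take k (applyUpTo (f ∘ suc) n)) + a (suc k)   ≡⟨ +-assoc (f 0) _ _ ⟩
  f 0 + (sum (take k (applyUpTo (f ∘ suc) n)) + a (suc k))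
    ≡⟨ cong (f 0 +_) (sum-take-telescope (f ∘ suc) (a ∘ suc) (step ∘ suc) n k k≤n) ⟩
  f 0 + a 1                                                ≡⟨ step 0 ⟨
  a 0                                                      ∎
  where open ≡-Reasoning

-- The caracol graph

-- The edges that survive once vertex `3 + r` is removed. Vertex 1 has spokes to all other vertices,
-- so the rim starts at 2; it has one edge fewer than there are spokes.
data CaracolEdge (r : ℕ) : Edge → Set where
  spoke : ∀ {j} → j ≤ r → CaracolEdge r (1 , 2 + j)
  rim   : ∀ {k} → k < r → CaracolEdge r (2 + k , 3 + k)

Car↾ : ℕ → Graph
Car↾ r = Car (3 + r) ↾ (2 + r)

∈-Car↾⁻ : ∀ {r e} → e ∈ Car↾ r → CaracolEdge r e
∈-Car↾⁻ {r} e∈ with ∈-filter⁻ (λ (p , q) → (p ≤? 2 + r) ×-dec (q ≤? 2 + r)) {xs = Car (3 + r)} e∈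
... | e∈Car , p≤ , q≤ with ∈-++⁻ (map (λ j → 1 , j) [ 2 ⋯ 2 + r ]) e∈Car
... | inj₁ e∈₁ with ∈-map⁻ _ e∈₁
... | _ , j∈ , refl with ∈-applyUpTo⁻ (2 +_) j∈
... | j , s≤s j≤r , refl = spoke j≤r
∈-Car↾⁻ {r} e∈ | e∈Car , p≤ , q≤ | inj₂ e∈₂₃ with ∈-++⁻ (map (λ i → i , suc i) [ 2 ⋯ 2 + r ]) e∈₂₃
... | inj₁ e∈₂ with ∈-map⁻ _ e∈₂
... | _ , k∈ , refl with ∈-applyUpTo⁻ (2 +_) k∈
-- In `Car (3 + r)` the rim goes one edge further; the bound on the target excludes that edge.
... | k , _ , refl = rim (s≤s⁻¹ (s≤s⁻¹ q≤))
∈-Car↾⁻ {r} e∈ | e∈Car , p≤ , q≤ | inj₂ e∈₂₃ | inj₂ e∈₃ with ∈-map⁻ _ e∈₃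
... | _ , _ , refl = contradiction q≤ 1+n≰n

∈-Car↾⁺ : ∀ {r e} → CaracolEdge r e → e ∈ Car↾ r
∈-Car↾⁺ {r} (spoke j≤r) =
  ∈-filter⁺ (λ (p , q) → (p ≤? 2 + r) ×-dec (q ≤? 2 + r))
    (∈-++⁺ˡ (∈-map⁺ (λ j → 1 , j) (∈-applyUpTo⁺ (2 +_) (s≤s j≤r)))) (s≤s z≤n , s≤s (s≤s j≤r))
∈-Car↾⁺ {r} (rim k<r) =
  ∈-filter⁺ (λ (p , q) → (p ≤? 2 + r) ×-dec (q ≤? 2 + r))
    (∈-++⁺ʳ (map (λ j → 1 , j) [ 2 ⋯ 2 + r ])
      (∈-++⁺ˡ (∈-map⁺ (λ i → i , suc i) (∈-applyUpTo⁺ (2 +_) (m<n⇒m<1+n k<r)))))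
    (s≤s (s≤s (<⇒≤ k<r)) , s≤s (s≤s k<r))

outDegree-Car-1 : ∀ r → outDegree (Car (3 + r)) 1 ≡ suc r
outDegree-Car-1 r = begin
  count from1? (E₁ ++ E₂ ++ E₃)                      ≡⟨ count-++ from1? E₁ (E₂ ++ E₃) ⟩
  count from1? E₁ + count from1? (E₂ ++ E₃)
    ≡⟨ cong₂ _+_ (count-all from1? {E₁} (All.map⁺ (All.universal (λ _ → refl) [ 2 ⋯ 2 + r ])))
                 (count-none from1? {E₂ ++ E₃} (All.++⁺
                   (All.map⁺ (All.applyUpTo⁺₂ {P = _≢ 1} (2 +_) (suc r) λ _ ()))
                   (All.map⁺ (All.applyUpTo⁺₂ {P = _≢ 1} (2 +_) r λ _ ())))) ⟩
  length E₁ + 0                                      ≡⟨ +-identityʳ _ ⟩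
  length E₁                                          ≡⟨ length-map _ [ 2 ⋯ 2 + r ] ⟩
  length [ 2 ⋯ 2 + r ]                               ≡⟨ length-applyUpTo (2 +_) (suc r) ⟩
  suc r                                              ∎
  where
  open ≡-Reasoning
  from1? : Decidable (λ (e : Edge) → proj₁ e ≡ 1)
  from1? (p , _) = p ≟ 1
  E₁ E₂ E₃ : Graph
  E₁ = map (λ j → 1 , j) [ 2 ⋯ 2 + r ]
  E₂ = map (λ i → i , suc i) [ 2 ⋯ 2 + r ]
  E₃ = map (λ i → i , 3 + r) [ 2 ⋯ 1 + r ]

-- The 1 is the rim edge; the remaining count is 1 if the vertex also has an edge to the sink
-- `3 + r` and 0 otherwise. Left unevaluated, it serves both the entries 1 of `𝐭` and its final 0.
outDegree-Car-2+ : ∀ r k → k ≤ r →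
  outDegree (Car (3 + r)) (2 + k) ≡ 1 + count (_≟ (2 + k)) [ 2 ⋯ 1 + r ]
outDegree-Car-2+ r k k≤r = begin
  count from? (E₁ ++ E₂ ++ E₃)                       ≡⟨ count-++ from? E₁ (E₂ ++ E₃) ⟩
  count from? E₁ + count from? (E₂ ++ E₃)
    ≡⟨ cong₂ _+_ (count-none from? {E₁} (All.map⁺ (All.universal (λ _ ()) [ 2 ⋯ 2 + r ])))
                 (count-++ from? E₂ E₃) ⟩
  count from? E₂ + count from? E₃
    ≡⟨ cong₂ _+_ (count-map from? (λ i → i , suc i) [ 2 ⋯ 2 + r ])
                (count-map from? (λ i → i , 3 + r) [ 2 ⋯ 1 + r ]) ⟩
  count (_≟ (2 + k)) [ 2 ⋯ 2 + r ] + count (_≟ (2 + k)) [ 2 ⋯ 1 + r ]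
    ≡⟨ cong (_+ count (_≟ (2 + k)) [ 2 ⋯ 1 + r ])
         (count-applyUpTo-one (_≟ (2 + k)) (2 +_) (s≤s k≤r) refl
                     (λ j j≢k → j≢k ∘ suc-injective ∘ suc-injective)) ⟩
  1 + count (_≟ (2 + k)) [ 2 ⋯ 1 + r ]               ∎
  where
  open ≡-Reasoning
  from? : Decidable (λ (e : Edge) → proj₁ e ≡ 2 + k)
  from? (p , _) = p ≟ 2 + k
  E₁ E₂ E₃ : Graph
  E₁ = map (λ j → 1 , j) [ 2 ⋯ 2 + r ]
  E₂ = map (λ i → i , suc i) [ 2 ⋯ 2 + r ]
  E₃ = map (λ i → i , 3 + r) [ 2 ⋯ 1 + r ]

toList-tabulate-toℕ : ∀ n (f : ℕ → A) → toList (Vec.tabulate {n = n} (f ∘ toℕ)) ≡ applyUpTo f n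
toList-tabulate-toℕ zero    f = refl
toList-tabulate-toℕ (suc n) f = cong (f 0 ∷_) (toList-tabulate-toℕ n (f ∘ suc))

applyUpTo-∷ʳ-const : {x y : A} (f : ℕ → A) (n : ℕ) → (∀ k → k < n → f k ≡ x) → f n ≡ y →
                     applyUpTo f (suc n) ≡ replicate n x ++ [ y ]
applyUpTo-∷ʳ-const f zero    _   fn≡y = cong [_] fn≡y
applyUpTo-∷ʳ-const f (suc n) f≡x fn≡y =
  cong₂ _∷_ (f≡x 0 z<s) (applyUpTo-∷ʳ-const (f ∘ suc) n (λ k k<n → f≡x (suc k) (s<s k<n)) fn≡y)

toList-𝐭 : ∀ r → toList (𝐭 r) ≡ r ∷ replicate r 1 ++ [ 0 ]
toList-𝐭 r = trans (toList-tabulate-toℕ (2 + r) (λ k → outDegree (Car (3 + r)) (suc k) ∸ 1))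
  (cong₂ _∷_ (cong (_∸ 1) (outDegree-Car-1 r))
    (applyUpTo-∷ʳ-const _ r
      (λ k k<r → cong (_∸ 1) (trans (outDegree-Car-2+ r k (<⇒≤ k<r))
        (cong suc (count-applyUpTo-one (_≟ (2 + k)) (2 +_) k<r refl
          (λ j j≢k → j≢k ∘ suc-injective ∘ suc-injective)))))
      (cong (_∸ 1) (trans (outDegree-Car-2+ r r ≤-refl)
        (cong suc (count-none (_≟ (2 + r)) (All.applyUpTo⁺₁ (2 +_) r
          (λ j<r → <⇒≢ j<r ∘ suc-injective ∘ suc-injective))))))))

sum-replicate-1 : ∀ n → sum (replicate n 1) ≡ n
sum-replicate-1 zero    = refl
sum-replicate-1 (suc n) = cong suc (sum-replicate-1 n)

sum-take-replicate-1 : ∀ {k n} (xs : List ℕ) → k ≤ n → sum (take k (replicate n 1 ++ xs)) ≡ k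
sum-take-replicate-1 xs z≤n       = refl
sum-take-replicate-1 xs (s≤s k≤n) = cong suc (sum-take-replicate-1 xs k≤n)

∣𝐭∣ : ∀ r → ∣ 𝐭 r ∣ᵥ ≡ r + r
∣𝐭∣ r = begin
  sum (toList (𝐭 r))                  ≡⟨ cong sum (toList-𝐭 r) ⟩
  r + sum (replicate r 1 ++ [ 0 ])    ≡⟨ cong (r +_) (sum-++ (replicate r 1) [ 0 ]) ⟩
  r + (sum (replicate r 1) + 0)       ≡⟨ cong (r +_) (trans (+-identityʳ _) (sum-replicate-1 r)) ⟩
  r + r                               ∎
  where open ≡-Reasoning

prefixSum-𝐭 : ∀ {r k} → k ≤ r → prefixSum (suc k) (𝐭 r) ≡ r + k
prefixSum-𝐭 {r} {k} k≤r = begin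
  sum (take (suc k) (toList (𝐭 r)))                ≡⟨ cong (sum ∘ take (suc k)) (toList-𝐭 r) ⟩
  r + sum (take k (replicate r 1 ++ [ 0 ]))        ≡⟨ cong (r +_) (sum-take-replicate-1 [ 0 ] k≤r) ⟩
  r + k                                            ∎
  where open ≡-Reasoning

-- Line-dot diagrams as lists of lines

Spans : ℕ → Pred Edge 0ℓ
Spans k (p , q) = p ≤ k × k < q

spans? : ∀ k → Decidable (Spans k)
spans? k (p , q) = (p ≤? k) ×-dec (k <? q)

_≟ᴱ_ : (e e′ : Edge) → Dec (e ≡ e′)
_≟ᴱ_ = ≡-dec _≟_ _≟_

-- The lines spanning a column are in bijection with its dots.
dots≡count : ∀ {m H} {v : Vec ℤ.ℤ (suc m)} (D : LineDotDiagram H v) (k : Fin m) →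
             LineDotDiagram.dots D k ≡ count (spans? (column k)) (LineDotDiagram.lines D)
dots≡count D k = begin
  dots k                                       ≡⟨ length-tabulate (lineOf k) ⟨
  length (tabulate (lineOf k))       ≡⟨ ↭-length (∼bag⇒↭ (unique∧set⇒bag
                                                    (Unique.tabulate⁺ lineOf-injective)
                                                    (positions-unique spans lines)
                                                    (mk⇔ to from))) ⟩
  length (positions spans lines)               ≡⟨ length-positions spans lines ⟩
  count spans lines                            ∎
  where
  open ≡-Reasoning
  open LineDotDiagram D
  spans = spans? (column k)
  lineOf-injective : ∀ {a b} → lineOf k a ≡ lineOf k b → a ≡ b
  lineOf-injective {a} {b} eq with onlySpan k b
  ... | p≤ , <q with oneOfEach k (lineOf k b) p≤ <q
  ... | _ , _ , unique = trans (sym (unique eq)) (unique refl)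
  to : ∀ {l} → l ∈ tabulate (lineOf k) → l ∈ positions spans lines
  to l∈ with ∈-tabulate⁻ l∈
  ... | a , refl = ∈-filter⁺ (spans ∘ lookup lines) (∈-allFin (lineOf k a)) (onlySpan k a)
  from : ∀ {l} → l ∈ positions spans lines → l ∈ tabulate (lineOf k)
  from {l} l∈ with ∈-filter⁻ (spans ∘ lookup lines) {xs = allFin (length lines)} l∈
  ... | _ , p≤ , <q with oneOfEach k l p≤ <q
  ... | a , refl , _ = ∈-tabulate⁺ a

-- The dots of a column are taken to be the lines crossing it, so that `lineOf` is an inclusion.
-- Only the number of crossing lines then remains to be checked.
fromLines : ∀ {m H} {v : Vec ℤ.ℤ (suc m)} (ls : List Edge) → All (_∈ H) ls →
            (∀ (k : Fin m) → ℤ.+ count (spans? (column k)) ls ≡ coefficient v (column k)) →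
            LineDotDiagram H v
fromLines ls ls⊆H coefficients = record
  { dots      = λ k → length (dotted k)
  ; dots-≡    = λ k → trans (cong ℤ.+_ (length-positions (spans? (column k)) ls)) (coefficients k)
  ; lines     = ls
  ; areEdges  = ls⊆H
  ; lineOf    = λ k → lookup (dotted k)
  ; onlySpan  = λ k a → proj₂ (∈-filter⁻ (spans? (column k) ∘ lookup ls) {xs = allFin (length ls)}
                                (∈-lookup {xs = dotted k} a))
  ; oneOfEach = λ k l p≤ <q →
      let l∈ = ∈-filter⁺ (spans? (column k) ∘ lookup ls) (∈-allFin l) (p≤ , <q) in
      index l∈ , sym (lookup-index l∈) , λ eq →
      lookup-injective (positions-unique (spans? (column k)) ls) _ _
        (trans (sym (lookup-index l∈)) (sym eq))
  }
  where
  dotted : ∀ k → List (Fin (length ls))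
  dotted k = positions (spans? (column k)) ls

⊖-+-⊖ : ∀ a b c d → (a ℤ.⊖ b) ℤ.+ (c ℤ.⊖ d) ≡ (a + c) ℤ.⊖ (b + d)
⊖-+-⊖ a b c d = begin
  (a ℤ.⊖ b) ℤ.+ (c ℤ.⊖ d)                      ≡⟨ cong₂ ℤ._+_ (ℤ.m-n≡m⊖n a b) (ℤ.m-n≡m⊖n c d) ⟨
  (+a ℤ.- +b) ℤ.+ (+c ℤ.- +d)                  ≡⟨ ℤ.+-assoc +a (ℤ.- +b) _ ⟩
  +a ℤ.+ (ℤ.- +b ℤ.+ (+c ℤ.- +d))
    ≡⟨ cong (λ x → +a ℤ.+ x) (ℤ.+-assoc (ℤ.- +b) +c (ℤ.- +d)) ⟨
  +a ℤ.+ (ℤ.- +b ℤ.+ +c ℤ.- +d)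
    ≡⟨ cong (λ x → +a ℤ.+ (x ℤ.- +d)) (ℤ.+-comm (ℤ.- +b) +c) ⟩
  +a ℤ.+ (+c ℤ.- +b ℤ.- +d)
    ≡⟨ cong (λ x → +a ℤ.+ x) (ℤ.+-assoc +c (ℤ.- +b) (ℤ.- +d)) ⟩
  +a ℤ.+ (+c ℤ.+ (ℤ.- +b ℤ.- +d))              ≡⟨ ℤ.+-assoc +a +c (ℤ.- +b ℤ.- +d) ⟨
  (+a ℤ.+ +c) ℤ.+ (ℤ.- +b ℤ.- +d)
    ≡⟨ cong₂ ℤ._+_ (ℤ.pos-+ a c)
         (trans (cong ℤ.-_ (ℤ.pos-+ b d)) (ℤ.neg-distrib-+ +b +d)) ⟨
  ℤ.+ (a + c) ℤ.- ℤ.+ (b + d)                  ≡⟨ ℤ.m-n≡m⊖n (a + c) (b + d) ⟩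
  (a + c) ℤ.⊖ (b + d)                          ∎
  where
  open ≡-Reasoning
  +a = ℤ.+ a
  +b = ℤ.+ b
  +c = ℤ.+ c
  +d = ℤ.+ d

coefficient-⊟ : ∀ {n} (s t : Vec ℕ n) k → coefficient (s ⊟ t) k ≡ prefixSum k s ℤ.⊖ prefixSum k t
coefficient-⊟ s       t       zero    = refl
coefficient-⊟ []      []      (suc k) = refl
coefficient-⊟ (x ∷ s) (y ∷ t) (suc k) =
  trans (cong (λ z → (x ℤ.⊖ y) ℤ.+ z) (coefficient-⊟ s t k))
        (⊖-+-⊖ x y (prefixSum k s) (prefixSum k t))

-- Moves the condition on the dots of a column from ℤ to an equation of sums in ℕ.
+≡⊖⇒+≡ : ∀ {d a b} → ℤ.+ d ≡ a ℤ.⊖ b → d + b ≡ a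
+≡⊖⇒+≡ {d} {a} {b} eq = ℤ.+-injective (begin
  ℤ.+ (d + b)            ≡⟨ ℤ.pos-+ d b ⟩
  ℤ.+ d ℤ.+ ℤ.+ b        ≡⟨ cong (λ z → z ℤ.+ ℤ.+ b) eq ⟩
  (a ℤ.⊖ b) ℤ.+ ℤ.+ b    ≡⟨ ℤ.distribˡ-⊖-+-pos b a b ⟩
  (a + b) ℤ.⊖ b          ≡⟨ ℤ.⊖-≥ (m≤n+m b a) ⟩
  ℤ.+ (a + b ∸ b)        ≡⟨ cong ℤ.+_ (m+n∸n≡m a b) ⟩
  ℤ.+ a                  ∎)
  where open ≡-Reasoning

+≡⇒+≡⊖ : ∀ {d a b} → d + b ≡ a → ℤ.+ d ≡ a ℤ.⊖ b
+≡⇒+≡⊖ {d} {b = b} refl = sym (trans (ℤ.⊖-≥ (m≤n+m b d)) (cong ℤ.+_ (m+n∸n≡m d b)))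

-- Flows on the restricted caracol graph

spokes : List Edge → ℕ → ℕ
spokes ls j = count ((1 , 2 + j) ≟ᴱ_) ls

module _ {r : ℕ} {ls : List Edge} (ls⊆Car : All (CaracolEdge r) ls) where

  private
    -- For lines on caracol edges, `a k` counts those on spokes `(1 , 2 + j)` with `k ≤ j`: the tail
    -- sums of `spokes ls`.
    a : ℕ → ℕ
    a k = count (λ (p , q) → (p ≟ 1) ×-dec (suc k <? q)) ls

    a-step : ∀ k → a k ≡ count ((1 , 2 + k) ≟ᴱ_) ls + a (suc k)
    a-step k = count-split _ _ _ (All.universal splits ls)
      where
      splits : ∀ e → Splits (λ (p , q) → p ≡ 1 × suc k < q) ((1 , 2 + k) ≡_)
                            (λ (p , q) → p ≡ 1 × 2 + k < q) e
      splits (p , q) with p ≟ 1 | <-cmp (2 + k) q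
      ... | no p≢1   | _            = neither (p≢1 ∘ proj₁) (λ { refl → p≢1 refl }) (p≢1 ∘ proj₁)
      ... | yes refl | tri< lt ne _ = right (refl , <⇒≤ lt) (ne ∘ cong proj₂) (refl , lt)
      ... | yes refl | tri≈ _ refl _ = left (refl , ≤-refl) refl (λ (_ , lt) → <-irrefl refl lt)
      ... | yes refl | tri> _ ne gt = neither (λ (_ , lt) → <⇒≱ gt lt) (ne ∘ cong proj₂)
                                             (λ (_ , lt) → <-asym gt lt)

    a-end : a (suc r) ≡ 0
    a-end = count-none (λ (p , q) → (p ≟ 1) ×-dec (2 + r <? q)) (All.map none ls⊆Car)
      where
      none : ∀ {e} → CaracolEdge r e → ¬ (proj₁ e ≡ 1 × 2 + r < proj₂ e)
      none (spoke j≤r) (_ , s≤s (s≤s j>r)) = <⇒≱ j>r j≤r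

  private
    count-spans-1≡a : count (spans? 1) ls ≡ a 0
    count-spans-1≡a = count-≐ _ _ (All.map iff ls⊆Car)
      where
      iff : ∀ {e} → CaracolEdge r e → (Spans 1 e → proj₁ e ≡ 1 × 1 < proj₂ e) ×
                                      (proj₁ e ≡ 1 × 1 < proj₂ e → Spans 1 e)
      iff (spoke j≤r) = (λ (_ , lt) → refl , lt) , (λ (_ , lt) → ≤-refl , lt)
      iff (rim k<r)   = (λ { (s≤s () , _) }) , (λ ())

  count-spans-1 : count (spans? 1) ls ≡ sum (applyUpTo (spokes ls) (suc r))
  count-spans-1 = begin
    count (spans? 1) ls                                         ≡⟨ count-spans-1≡a ⟩
    a 0
      ≡⟨ sum-take-telescope (spokes ls) a a-step (suc r) (suc r) ≤-refl ⟨
    sum (take (suc r) (applyUpTo (spokes ls) (suc r))) + a (suc r)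
      ≡⟨ cong₂ _+_ (cong sum (take-all _ _ (≤-reflexive (length-applyUpTo (spokes ls) (suc r))))) a-end ⟩
    sum (applyUpTo (spokes ls) (suc r)) + 0                          ≡⟨ +-identityʳ _ ⟩
    sum (applyUpTo (spokes ls) (suc r))                              ∎
    where open ≡-Reasoning

  -- Column `2 + k` is crossed by the spokes that end beyond vertex `2 + k` and by exactly one rim
  -- edge. Adding back the `suc k` spokes that end earlier or there completes the former to all
  -- spokes, which are the lines crossing column 1.
  count-spans-2+ : ∀ {k} → k < r →
    count (spans? (2 + k)) ls + sum (take (suc k) (applyUpTo (spokes ls) r)) ≡
    count (spans? 1) ls + count ((2 + k , 3 + k) ≟ᴱ_) ls
  count-spans-2+ {k} k<r = begin
    count (spans? (2 + k)) ls + F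
      ≡⟨ cong (_+ F) (count-split _ _ _ (All.map splits ls⊆Car)) ⟩
    a (suc k) + G + F              ≡⟨ +-comm _ F ⟩
    F + (a (suc k) + G)            ≡⟨ +-assoc F _ G ⟨
    F + a (suc k) + G
      ≡⟨ cong (_+ G) (sum-take-telescope (spokes ls) a a-step r (suc k) k<r) ⟩
    a 0 + G                        ≡⟨ cong (_+ G) count-spans-1≡a ⟨
    count (spans? 1) ls + G        ∎
    where
    open ≡-Reasoning
    F = sum (take (suc k) (applyUpTo (spokes ls) r))
    G = count ((2 + k , 3 + k) ≟ᴱ_) ls
    splits : ∀ {e} → CaracolEdge r e →
             Splits (Spans (2 + k)) (λ (p , q) → p ≡ 1 × 2 + k < q) ((2 + k , 3 + k) ≡_) e
    splits (spoke {j} j≤r) with 2 + k <? 2 + j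
    ... | yes lt = left (s≤s z≤n , lt) (refl , lt) (λ ())
    ... | no ≮   = neither (≮ ∘ proj₂) (≮ ∘ proj₂) (λ ())
    splits (rim {l} l<r) with k ≟ l
    ... | yes refl = right (≤-refl , ≤-refl) (λ ()) refl
    ... | no k≢l   = neither
      (λ (p≤ , <q) → k≢l (≤-antisym (s≤s⁻¹ (s≤s⁻¹ (s≤s⁻¹ <q))) (s≤s⁻¹ (s≤s⁻¹ p≤))))
      (λ ()) (k≢l ∘ λ { refl → refl })

  -- The longest spoke crosses every column, in particular the last one.
  count-spans-end : count (spans? (suc r)) ls ≡ 0 → spokes ls r ≡ 0
  count-spans-end none = n≤0⇒n≡0 (≤-trans
    (count-mono ((1 , 2 + r) ≟ᴱ_) (spans? (suc r)) (λ { refl → s≤s z≤n , ≤-refl }) ls)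
    (≤-reflexive none))

-- Labelled paths by columns

-- The number of zeros and the list of other labels. The pair can be read off the labels only if the
-- list contains no 0, hence the positivity conditions on columns below.
Column : Set
Column = ℕ × List ℕ

columnLabels : Column → List ℕ
columnLabels (f , b) = replicate f 0 ++ b

height : Column → ℕ
height (f , b) = f + length b

path : List Column → List Step
path []       = []
path (c ∷ cs) = map N (columnLabels c) ++ E ∷ path cs

labels-map-N : ∀ ls w → labels (map N ls ++ w) ≡ ls ++ labels w
labels-map-N []       w = refl
labels-map-N (l ∷ ls) w = cong (l ∷_) (labels-map-N ls w)

#E-map-N : ∀ ls w → #E (map N ls ++ w) ≡ #E w
#E-map-N []       w = refl
#E-map-N (l ∷ ls) w = #E-map-N ls w

#E-path : ∀ cs → #E (path cs) ≡ length cs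
#E-path []       = refl
#E-path (c ∷ cs) = trans (#E-map-N (columnLabels c) (E ∷ path cs)) (cong suc (#E-path cs))

labels-path : ∀ cs → labels (path cs) ↭ replicate (sum (map proj₁ cs)) 0 ++ concat (map proj₂ cs)
labels-path []             = ↭-refl
labels-path ((f , b) ∷ cs) = begin
  labels (map N (replicate f 0 ++ b) ++ E ∷ path cs)
    ≡⟨ labels-map-N (replicate f 0 ++ b) (E ∷ path cs) ⟩
  (replicate f 0 ++ b) ++ labels (path cs)
    ↭⟨ ++⁺ˡ (replicate f 0 ++ b) (labels-path cs) ⟩
  (replicate f 0 ++ b) ++ replicate F 0 ++ bs          ≡⟨ ++-assoc (replicate f 0) b _ ⟩
  replicate f 0 ++ b ++ replicate F 0 ++ bs
    ↭⟨ ++⁺ˡ (replicate f 0) (shifts b (replicate F 0)) ⟩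
  replicate f 0 ++ replicate F 0 ++ b ++ bs
    ≡⟨ ++-assoc (replicate f 0) (replicate F 0) _ ⟨
  (replicate f 0 ++ replicate F 0) ++ b ++ bs          ≡⟨ cong (_++ b ++ bs) (replicate-+ f) ⟨
  replicate (f + F) 0 ++ b ++ bs                       ∎
  where
  open PermutationReasoning
  F = sum (map proj₁ cs)
  bs = concat (map proj₂ cs)
  replicate-+ : ∀ m {n} → replicate (m + n) 0 ≡ replicate m 0 ++ replicate n 0
  replicate-+ zero    = refl
  replicate-+ (suc m) = cong (0 ∷_) (replicate-+ m)

-- The diagonal condition for a path that starts `d` steps above the diagonal, as needed for
-- induction on the word; for `d = 0` it is the field `aboveDiag`.
Above : ℕ → List Step → Set
Above d w = ∀ k → #E (take k w) ≤ d + #N (take k w)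

above-N⁺ : ∀ {d a w} → Above (suc d) w → Above d (N a ∷ w)
above-N⁺         p zero    = z≤n
above-N⁺ {d} p (suc k) = ≤-trans (p k) (≤-reflexive (sym (+-suc d _)))

above-N⁻ : ∀ {d a w} → Above d (N a ∷ w) → Above (suc d) w
above-N⁻ {d} p k = ≤-trans (p (suc k)) (≤-reflexive (+-suc d _))

above-E⁺ : ∀ {d w} → Above d w → Above (suc d) (E ∷ w)
above-E⁺ p zero    = z≤n
above-E⁺ p (suc k) = s≤s (p k)

above-E⁻ : ∀ {d w} → Above (suc d) (E ∷ w) → Above d w
above-E⁻ p k = s≤s⁻¹ (p (suc k))

above-E-pos : ∀ {d w} → Above d (E ∷ w) → 0 < d
above-E-pos {d} p = ≤-trans (p 1) (≤-reflexive (+-identityʳ d))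

-- The condition ranges over all `k`; reading the word with the surplus as a counter makes it
-- decidable.
above? : ∀ d w → Dec (Above d w)
above? d       []        = yes λ { zero → z≤n ; (suc k) → z≤n }
above? d       (N a ∷ w) = map′ above-N⁺ above-N⁻ (above? (suc d) w)
above? zero    (E ∷ w)   = no λ p → contradiction (above-E-pos p) λ ()
above? (suc d) (E ∷ w)   = map′ above-E⁺ above-E⁻ (above? d w)

above-map-N⁺ : ∀ {d w} ls → Above (length ls + d) w → Above d (map N ls ++ w)
above-map-N⁺         []       p = p
above-map-N⁺ {d} {w} (l ∷ ls) p =
  above-N⁺ (above-map-N⁺ ls (subst (λ e → Above e w) (sym (+-suc (length ls) d)) p))

above-map-N⁻ : ∀ {d w} ls → Above d (map N ls ++ w) → Above (length ls + d) w
above-map-N⁻         []       p = p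
above-map-N⁻ {d} {w} (l ∷ ls) p =
  subst (λ e → Above e w) (+-suc (length ls) d) (above-map-N⁻ ls (above-N⁻ p))

length-columnLabels : ∀ c → length (columnLabels c) ≡ height c
length-columnLabels (f , b) =
  trans (length-++ (replicate f 0)) (cong (_+ length b) (length-replicate f))

-- The diagonal condition tested only after each east step. This suffices because north steps can
-- only raise the surplus.
Ballot : ℕ → List Column → Set
Ballot d cs = ∀ k → k ≤ length cs → k ≤ d + sum (take k (map height cs))

private
  swap-+ : ∀ a b c → a + (b + c) ≡ b + a + c
  swap-+ = solve-∀

above-path⁺ : ∀ {d} cs → Ballot d cs → Above d (path cs)
above-path⁺ []       b zero    = z≤n
above-path⁺ []       b (suc k) = z≤n
above-path⁺ {d} (c ∷ cs) b = above-map-N⁺ (columnLabels c)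
  (subst (λ h → Above (h + d) (E ∷ path cs)) (sym (length-columnLabels c))
    (aux (height c + d) refl))
  where
  heights : ℕ → ℕ
  heights k = sum (take k (map height cs))
  -- The surplus before the east step is generalised to `e` so that it can be matched; `e = 0`
  -- contradicts the bound for the first column.
  aux : ∀ e → height c + d ≡ e → Above e (E ∷ path cs)
  aux zero    eq = contradiction
    (≤-trans (b 1 (s≤s z≤n))
      (≤-reflexive (trans (swap-+ d (height c) 0) (trans (+-identityʳ _) eq)))) λ ()
  aux (suc e) eq = above-E⁺ (above-path⁺ cs λ k k≤ → s≤s⁻¹
    (≤-trans (b (suc k) (s≤s k≤))
      (≤-reflexive (trans (swap-+ d (height c) (heights k)) (cong (_+ heights k) eq)))))

above-path⁻ : ∀ {d} cs → Above d (path cs) → Ballot d cs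
above-path⁻         cs       p zero    _ = z≤n
above-path⁻ {d} (c ∷ cs) p (suc k) (s≤s k≤) =
  aux (height c + d) refl
      (subst (λ h → Above (h + d) (E ∷ path cs)) (length-columnLabels c)
        (above-map-N⁻ (columnLabels c) p))
  where
  heights : ℕ → ℕ
  heights k = sum (take k (map height cs))
  aux : ∀ e → height c + d ≡ e → Above e (E ∷ path cs) →
        suc k ≤ d + sum (take (suc k) (map height (c ∷ cs)))
  aux zero    eq p = contradiction (above-E-pos p) λ ()
  aux (suc e) eq p = ≤-trans (s≤s (above-path⁻ cs (above-E⁻ p) k k≤))
    (≤-reflexive (sym (trans (swap-+ d (height c) (heights k)) (cong (_+ heights k) eq))))

sum-take-height : ∀ k cs → sum (take k (map height cs)) ≡
                  sum (take k (map proj₁ cs)) + sum (take k (map (length ∘ proj₂) cs))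
sum-take-height zero    cs       = refl
sum-take-height (suc k) []       = refl
sum-take-height (suc k) ((f , b) ∷ cs) =
  trans (cong (f + length b +_) (sum-take-height k cs)) (interchange f (length b) _ _)
  where
  interchange : ∀ a b c d → a + b + (c + d) ≡ a + c + (b + d)
  interchange = solve-∀

linked-map-N-E : ∀ {ls w} → Linked _≤_ ls → Linked _⊑_ w → Linked _⊑_ (map N ls ++ E ∷ w)
linked-map-N-E {w = []}    []       q = [-]
linked-map-N-E {w = _ ∷ _} []       q = E- ∷ q
linked-map-N-E             [-]      q = -E ∷ linked-map-N-E [] q
linked-map-N-E             (a ∷ as) q = NN a ∷ linked-map-N-E as q

linked-columnLabels : ∀ f {b} → Linked _≤_ b → Linked _≤_ (replicate f 0 ++ b)
linked-columnLabels zero          p = p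
linked-columnLabels (suc zero) {[]}    p = [-]
linked-columnLabels (suc zero) {_ ∷ _} p = z≤n ∷ p
linked-columnLabels (suc (suc f)) p = z≤n ∷ linked-columnLabels (suc f) p

linked-path : ∀ {cs} → All (Linked _≤_ ∘ proj₂) cs → Linked _⊑_ (path cs)
linked-path []       = []
linked-path {(f , _) ∷ _} (p ∷ ps) = linked-map-N-E (linked-columnLabels f p) (linked-path ps)

-- Recovering the columns from a path

-- Steps are stripped from the front, so the diagonal condition is phrased for suffixes, where it is
-- inherited. It excludes a north step with no east step after it, which would belong to no column.
columns : ∀ w → Linked _⊑_ w → (∀ k → #N (drop k w) ≤ #E (drop k w)) →
          ∃ λ cs → path cs ≡ w × All (All (0 <_) ∘ proj₂) cs × All (Linked _≤_ ∘ proj₂) cs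
columns []          _ _ = [] , refl , [] , []
columns (E ∷ w)     p q with columns w (Linked.tail p) (q ∘ suc)
... | cs , refl , ps , ls = (0 , []) ∷ cs , refl , [] ∷ ps , [] ∷ ls
columns (N a ∷ w)   p q with columns w (Linked.tail p) (q ∘ suc)
... | [] , refl , _ = contradiction (q 0) λ ()
columns (N zero    ∷ _) p q | (f , b) ∷ cs , refl , ps ∷ pss , ls ∷ lss =
  (suc f , b) ∷ cs , refl , ps ∷ pss , ls ∷ lss
-- A positive label cannot stand directly before a 0 in the same column.
columns (N (suc a) ∷ _) (NN () ∷ _) q | (suc f , b) ∷ cs , refl , _
columns (N (suc a) ∷ _) p q | (zero , []) ∷ cs , refl , ps ∷ pss , ls ∷ lss =
  (0 , suc a ∷ []) ∷ cs , refl , (z<s ∷ []) ∷ pss , [-] ∷ lss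
columns (N (suc a) ∷ _) (NN a<b ∷ _) q | (zero , b ∷ bs) ∷ cs , refl , ps ∷ pss , ls ∷ lss =
  (0 , suc a ∷ b ∷ bs) ∷ cs , refl , (z<s ∷ ps) ∷ pss , (a<b ∷ ls) ∷ lss

#E-++ : ∀ v w → #E (v ++ w) ≡ #E v + #E w
#E-++ []        w = refl
#E-++ (N _ ∷ v) w = #E-++ v w
#E-++ (E   ∷ v) w = cong suc (#E-++ v w)

#N-++ : ∀ v w → #N (v ++ w) ≡ #N v + #N w
#N-++ []        w = refl
#N-++ (N _ ∷ v) w = cong suc (#N-++ v w)
#N-++ (E   ∷ v) w = #N-++ v w

-- The totals agree, so a surplus of north steps in a prefix is a surplus of east steps in the
-- complementary suffix.
above⇒suffix : ∀ w → Above 0 w → #N w ≡ #E w → ∀ k → #N (drop k w) ≤ #E (drop k w)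
above⇒suffix w p eq k = +-cancelˡ-≤ (#N (take k w)) _ _ (begin
  #N (take k w) + #N (drop k w)    ≡⟨ #N-++ (take k w) (drop k w) ⟨
  #N (take k w ++ drop k w)        ≡⟨ cong #N (take++drop≡id k w) ⟩
  #N w                             ≡⟨ eq ⟩
  #E w                             ≡⟨ cong #E (take++drop≡id k w) ⟨
  #E (take k w ++ drop k w)        ≡⟨ #E-++ (take k w) (drop k w) ⟩
  #E (take k w) + #E (drop k w)    ≤⟨ +-monoˡ-≤ _ (p k) ⟩
  #N (take k w) + #E (drop k w)    ∎)
  where open ≤-Reasoning

N-injective : ∀ {a b} → N a ≡ N b → a ≡ b
N-injective refl = refl

-- The end of the zeros is marked by the first positive label or by the closing `E`, so comparing
-- first letters settles every case.
column-injective : ∀ f f′ {b b′ v v′} → All (0 <_) b → All (0 <_) b′ →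
  map N (columnLabels (f , b)) ++ E ∷ v ≡ map N (columnLabels (f′ , b′)) ++ E ∷ v′ →
  (f , b) ≡ (f′ , b′) × v ≡ v′
column-injective zero    zero     []       []       eq = refl , ∷-injectiveʳ eq
column-injective zero    zero     (_ ∷ ps) (_ ∷ qs) eq with ∷-injective eq
... | refl , eq′ with column-injective zero zero ps qs eq′
... | refl , v≡v′ = refl , v≡v′
column-injective (suc f) (suc f′) ps       qs       eq
  with column-injective f f′ ps qs (∷-injectiveʳ eq)
... | refl , v≡v′ = refl , v≡v′
column-injective zero    zero     []       (_ ∷ _)  ()
column-injective zero    zero     (_ ∷ _)  []       ()
column-injective zero    (suc f′) []       qs       ()
column-injective zero    (suc f′) (0<x ∷ _) qs      eq with ∷-injectiveˡ eq
... | refl = contradiction 0<x λ ()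
column-injective (suc f) zero     ps       []       ()
column-injective (suc f) zero     ps       (0<x ∷ _) eq with ∷-injectiveˡ eq
... | refl = contradiction 0<x λ ()

path≢[] : ∀ c cs → path (c ∷ cs) ≢ []
path≢[] (zero , [])    cs ()
path≢[] (zero , _ ∷ _) cs ()
path≢[] (suc _ , _)    cs ()

path-injective : ∀ {cs cs′} → All (All (0 <_) ∘ proj₂) cs → All (All (0 <_) ∘ proj₂) cs′ →
                 path cs ≡ path cs′ → cs ≡ cs′
path-injective []       []       eq = refl
path-injective []       (_∷_ {c} {cs} _ _) eq = contradiction (sym eq) (path≢[] c cs)
path-injective (_∷_ {c} {cs} _ _) []       eq = contradiction eq (path≢[] c cs)
path-injective {(f , b) ∷ cs} {(f′ , b′) ∷ cs′} (p ∷ ps) (q ∷ qs) eq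
  with column-injective f f′ p q eq
... | refl , eq′ = cong (_ ∷_) (path-injective ps qs eq′)

-- Cutting a word into blocks

blocks-concat : (bs : List (List A)) → blocks (map length bs) (concat bs) ≡ bs
blocks-concat []       = refl
blocks-concat (b ∷ bs) = cong₂ _∷_ (take-length-++ b)
  (trans (cong (blocks (map length bs)) (drop-length-++ b)) (blocks-concat bs))
  where
  take-length-++ : (xs : List A) {ys : List A} → take (length xs) (xs ++ ys) ≡ xs
  take-length-++ []       = refl
  take-length-++ (x ∷ xs) = cong (x ∷_) (take-length-++ xs)
  drop-length-++ : (xs : List A) {ys : List A} → drop (length xs) (xs ++ ys) ≡ ys
  drop-length-++ []       = refl
  drop-length-++ (x ∷ xs) = drop-length-++ xs

length-blocks : ∀ ms (xs : List A) → length (blocks ms xs) ≡ length ms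
length-blocks []       xs = refl
length-blocks (m ∷ ms) xs = cong suc (length-blocks ms (drop m xs))

sum≡length-drop : ∀ m {n} (xs : List A) → m + n ≡ length xs → n ≡ length (drop m xs)
sum≡length-drop m xs eq =
  sym (trans (length-drop m xs) (trans (cong (_∸ m) (sym eq)) (m+n∸m≡n m _)))

map-length-blocks : ∀ ms (xs : List A) → sum ms ≡ length xs → map length (blocks ms xs) ≡ ms
map-length-blocks []       xs eq = refl
map-length-blocks (m ∷ ms) xs eq = cong₂ _∷_
  (trans (length-take m xs) (m≤n⇒m⊓n≡m (≤-trans (m≤m+n m _) (≤-reflexive eq))))
  (map-length-blocks ms (drop m xs) (sum≡length-drop m xs eq))

concat-blocks : ∀ ms (xs : List A) → sum ms ≡ length xs → concat (blocks ms xs) ≡ xs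
concat-blocks []       []       eq = refl
concat-blocks (m ∷ ms) xs       eq =
  trans (cong (take m xs ++_) (concat-blocks ms (drop m xs) (sum≡length-drop m xs eq)))
        (take++drop≡id m xs)

-- Accounts for the last entry of `s`: being 0, it only appends an empty block to those of the `r`
-- columns of the path.
blocks-∷ʳ-0 : ∀ ms (xs : List A) → blocks (ms ++ [ 0 ]) xs ≡ blocks ms xs ++ [ [] ]
blocks-∷ʳ-0 []       xs = refl
blocks-∷ʳ-0 (m ∷ ms) xs = cong (take m xs ∷_) (blocks-∷ʳ-0 ms (drop m xs))

all-blocks : ∀ {P : A → Set} ms {xs} → All P xs → All (All P) (blocks ms xs)
all-blocks []       ps = []
all-blocks (m ∷ ms) ps = All.take⁺ m ps ∷ all-blocks ms (All.drop⁺ m ps)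

≤-linked⇒<-linked : ∀ {xs} → Unique xs → Linked _≤_ xs → Linked _<_ xs
≤-linked⇒<-linked _              []       = []
≤-linked⇒<-linked _              [-]      = [-]
≤-linked⇒<-linked ((x≢y ∷ _) ∷ u) (x≤y ∷ l) = ≤∧≢⇒< x≤y x≢y ∷ ≤-linked⇒<-linked u l

unique-concat : {xss : List (List A)} → Unique (concat xss) → All Unique xss
unique-concat {xss = []}       _ = []
unique-concat {xss = []       ∷ xss} u        = [] ∷ unique-concat u
unique-concat {xss = (x ∷ xs) ∷ xss} (x∉ ∷ u) with unique-concat {xss = xs ∷ xss} u
... | u₁ ∷ us = (All.++⁻ˡ xs x∉ ∷ u₁) ∷ us

map-proj₁-zip : (xs : List A) (ys : List B) → length xs ≡ length ys → map proj₁ (zip xs ys) ≡ xs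
map-proj₁-zip []       []       _  = refl
map-proj₁-zip (x ∷ xs) (y ∷ ys) eq = cong (x ∷_) (map-proj₁-zip xs ys (suc-injective eq))

map-proj₂-zip : (xs : List A) (ys : List B) → length xs ≡ length ys → map proj₂ (zip xs ys) ≡ ys
map-proj₂-zip []       []       _  = refl
map-proj₂-zip (x ∷ xs) (y ∷ ys) eq = cong (y ∷_) (map-proj₂-zip xs ys (suc-injective eq))

zip-proj : (xys : List (A × B)) → zip (map proj₁ xys) (map proj₂ xys) ≡ xys
zip-proj []        = refl
zip-proj (xy ∷ xys) = cong (xy ∷_) (zip-proj xys)

take≡++0 : ∀ n xs → length xs ≡ suc n → sum (take n xs) ≡ sum xs → xs ≡ take n xs ++ [ 0 ]
take≡++0 zero    (x ∷ [])    _    eq = cong [_] (trans (sym (+-identityʳ x)) (sym eq))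
take≡++0 (suc n) (x ∷ xs) len eq =
  cong (x ∷_) (take≡++0 n xs (suc-injective len) (+-cancelˡ-≡ x _ _ eq))

take-++-≤ : ∀ k (xs : List A) {ys} → k ≤ length xs → take k (xs ++ ys) ≡ take k xs
take-++-≤ zero    xs       _        = refl
take-++-≤ (suc k) (x ∷ xs) (s≤s k≤) = cong (x ∷_) (take-++-≤ k xs k≤)

sum-applyUpTo-suc : ∀ (f : ℕ → ℕ) n → sum (applyUpTo f (suc n)) ≡ sum (applyUpTo f n) + f n
sum-applyUpTo-suc f n = begin
  sum (applyUpTo f (suc n))            ≡⟨ cong sum (applyUpTo-∷ʳ f n) ⟨
  sum (applyUpTo f n ++ [ f n ])       ≡⟨ sum-++ (applyUpTo f n) [ f n ] ⟩
  sum (applyUpTo f n) + (f n + 0)      ≡⟨ cong (sum (applyUpTo f n) +_) (+-identityʳ (f n)) ⟩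
  sum (applyUpTo f n) + f n            ∎
  where open ≡-Reasoning

sum-map-length : (xss : List (List A)) → sum (map length xss) ≡ length (concat xss)
sum-map-length []         = refl
sum-map-length (xs ∷ xss) = trans (cong (length xs +_) (sum-map-length xss)) (sym (length-++ xs))

toList-injective : ∀ {n} (xs ys : Vec A n) → toList xs ≡ toList ys → xs ≡ ys
toList-injective xs ys eq =
  trans (sym (Vec.cast-is-id refl xs)) (Vec.toList-injective refl xs ys eq)

vecOf : ∀ (xs : List A) {n} → length xs ≡ n → ∃ λ (v : Vec A n) → toList v ≡ xs
vecOf xs refl = fromList xs , Vec.toList∘fromList xs

prefixSum-all : ∀ {n} (v : Vec ℕ n) → prefixSum n v ≡ ∣ v ∣ᵥ
prefixSum-all v = cong sum (take-all _ (toList v) (≤-reflexive (Vec.length-toList v)))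

-- The map from diagrams to paths

module FromDiagram {r i : ℕ} (u : UnifiedDiagram r i) where
  open UnifiedDiagram u
  open LineDotDiagram D using (dots; dots-≡; lines; areEdges; multiplicity)

  -- The inner entries of `s`, from the second to the one before the last; by `tail≡` the last is 0.
  norths : List ℕ
  norths = take r (toList (tail s))

  zeros : List ℕ
  zeros = applyUpTo (spokes lines) r

  private
    lines⊆Car : All (CaracolEdge r) lines
    lines⊆Car = All.map ∈-Car↾⁻ areEdges

    toList-s : toList s ≡ head s ∷ toList (tail s)
    toList-s with s
    ... | _ ∷ _ = refl

    head+i : head s + i ≡ r + r
    head+i = trans level (∣𝐭∣ r)

    prefixSum-s : ∀ k → prefixSum (suc k) s ≡ head s + sum (take k (toList (tail s)))
    prefixSum-s k = cong (sum ∘ take (suc k)) toList-s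

    sum-tail : sum (toList (tail s)) ≡ i
    sum-tail = +-cancelˡ-≡ (head s) _ _ (begin
      head s + sum (toList (tail s))     ≡⟨ cong sum toList-s ⟨
      ∣ s ∣ᵥ                             ≡⟨ IsDyck.total isDyck ⟩
      ∣ 𝐭 r ∣ᵥ                           ≡⟨ level ⟨
      head s + i                         ∎)
      where open ≡-Reasoning

  -- The first `suc r` entries of `𝐭` already sum to `r + r`, so domination at that point leaves
  -- nothing for the last entry of `s`.
  sum-norths : sum norths ≡ i
  sum-norths = ≤-antisym
    (≤-trans (sum-take-≤ r (toList (tail s))) (≤-reflexive sum-tail))
    (+-cancelˡ-≤ (head s) _ _ (begin
      head s + i                 ≡⟨ head+i ⟩
      r + r                      ≡⟨ prefixSum-𝐭 {r} ≤-refl ⟨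
      prefixSum (suc r) (𝐭 r)    ≤⟨ IsDyck.dominates isDyck (suc r) (n≤1+n (suc r)) ⟩
      prefixSum (suc r) s        ≡⟨ prefixSum-s r ⟩
      head s + sum norths        ∎))
    where open ≤-Reasoning

  tail≡ : toList (tail s) ≡ norths ++ [ 0 ]
  tail≡ = take≡++0 r (toList (tail s)) (Vec.length-toList (tail s))
            (trans sum-norths (sym sum-tail))

  length-norths : length norths ≡ r
  length-norths = trans (length-take r _)
    (m≤n⇒m⊓n≡m (≤-trans (n≤1+n r) (≤-reflexive (sym (Vec.length-toList (tail s))))))

  private
    column-eq : ∀ {k} → k ≤ r →
                count (spans? (suc k)) lines + (r + k) ≡ head s + sum (take k norths)
    column-eq {k} k≤r = begin
      count (spans? (suc k)) lines + (r + k)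
        ≡⟨ cong₂ (λ j → count (spans? (suc j)) lines +_) (sym toℕ-col) (sym (prefixSum-𝐭 k≤r)) ⟩
      count (spans? (column col)) lines + prefixSum (suc k) (𝐭 r)
        ≡⟨ +≡⊖⇒+≡ (begin
             ℤ.+ count (spans? (column col)) lines             ≡⟨ cong ℤ.+_ (dots≡count D col) ⟨
             ℤ.+ dots col                                      ≡⟨ dots-≡ col ⟩
             coefficient (s ⊟ 𝐭 r) (column col)
               ≡⟨ cong (coefficient (s ⊟ 𝐭 r) ∘ suc) toℕ-col ⟩
             coefficient (s ⊟ 𝐭 r) (suc k)                     ≡⟨ coefficient-⊟ s (𝐭 r) (suc k) ⟩
             prefixSum (suc k) s ℤ.⊖ prefixSum (suc k) (𝐭 r)   ∎) ⟩
      prefixSum (suc k) s                              ≡⟨ prefixSum-s k ⟩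
      head s + sum (take k (toList (tail s)))
        ≡⟨ cong (λ xs → head s + sum (take k xs)) tail≡ ⟩
      head s + sum (take k (norths ++ [ 0 ]))
        ≡⟨ cong (λ xs → head s + sum xs) (take-++-≤ k norths (≤-trans k≤r (≤-reflexive (sym length-norths)))) ⟩
      head s + sum (take k norths)                     ∎
      where
      open ≡-Reasoning
      col : Fin (suc r)
      col = fromℕ< (s≤s k≤r)
      toℕ-col : toℕ col ≡ k
      toℕ-col = Fin.toℕ-fromℕ< (s≤s k≤r)

    column-1 : count (spans? 1) lines + r ≡ head s
    column-1 = begin
      count (spans? 1) lines + r         ≡⟨ cong (count (spans? 1) lines +_) (+-identityʳ r) ⟨
      count (spans? 1) lines + (r + 0)   ≡⟨ column-eq z≤n ⟩
      head s + 0                         ≡⟨ +-identityʳ _ ⟩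
      head s                             ∎
      where open ≡-Reasoning

  -- The last column has `head s + i` minus `r + r` dots, hence none, and this spoke would cross it.
  last-spoke : multiplicity (1 , 2 + r) ≡ 0
  last-spoke = count-spans-end lines⊆Car (+-cancelʳ-≡ (r + r) _ 0 (begin
    count (spans? (suc r)) lines + (r + r)    ≡⟨ column-eq ≤-refl ⟩
    head s + sum (take r norths)
      ≡⟨ cong (λ xs → head s + sum xs) (take-all r norths (≤-reflexive length-norths)) ⟩
    head s + sum norths                       ≡⟨ cong (head s +_) sum-norths ⟩
    head s + i                                ≡⟨ head+i ⟩
    r + r                                     ∎))
    where open ≡-Reasoning

  private
    sum-zeros≡ : sum zeros ≡ count (spans? 1) lines
    sum-zeros≡ = begin
      sum zeros                                          ≡⟨ +-identityʳ _ ⟨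
      sum zeros + 0                                      ≡⟨ cong (sum zeros +_) last-spoke ⟨
      sum zeros + multiplicity (1 , 2 + r)               ≡⟨ sum-applyUpTo-suc (spokes lines) r ⟨
      sum (applyUpTo (spokes lines) (suc r)) ≡⟨ count-spans-1 lines⊆Car ⟨
      count (spans? 1) lines                             ∎
      where open ≡-Reasoning

  -- Column 1 is crossed by spokes only and has `head s` minus `r` dots, where `head s + i` is
  -- `r + r`.
  sum-zeros : sum zeros + i ≡ r
  sum-zeros = +-cancelʳ-≡ r _ _ (begin
    sum zeros + i + r                   ≡⟨ cong (λ x → x + i + r) sum-zeros≡ ⟩
    count (spans? 1) lines + i + r      ≡⟨ swap (count (spans? 1) lines) i r ⟩
    count (spans? 1) lines + r + i      ≡⟨ cong (_+ i) column-1 ⟩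
    head s + i                          ≡⟨ head+i ⟩
    r + r                               ∎)
    where
    open ≡-Reasoning
    swap : ∀ a b c → a + b + c ≡ a + c + b
    swap = solve-∀

  rim-flow : ∀ {k} → k < r → multiplicity (2 + k , 3 + k) + suc k ≡
             sum (take (suc k) zeros) + sum (take (suc k) norths)
  -- Column `2 + k` is counted through its coefficient and through the edges crossing it. Its number
  -- of dots `c` and that of column 1, `a`, are eliminated.
  rim-flow {k} k<r = combine {c = count (spans? (2 + k)) lines} {r} {z = sum (take (suc k) zeros)}
             (column-eq k<r) (count-spans-2+ lines⊆Car k<r) column-1
    where
    open ≡-Reasoning
    combine : ∀ {c r k h n a z g} → c + (r + k) ≡ h + n → c + z ≡ a + g → a + r ≡ h → g + k ≡ z + n
    combine {c} {r} {k} {n = n} {a} {z} {g} eq₁ eq₂ refl = +-cancelˡ-≡ (a + r) _ _ (begin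
      a + r + (g + k)      ≡⟨ lemma₁ a r g k ⟩
      a + g + (r + k)      ≡⟨ cong (_+ (r + k)) eq₂ ⟨
      c + z + (r + k)      ≡⟨ lemma₂ c z r k ⟩
      c + (r + k) + z      ≡⟨ cong (_+ z) eq₁ ⟩
      a + r + n + z        ≡⟨ lemma₃ a r n z ⟩
      a + r + (z + n)      ∎)
      where
      lemma₁ : ∀ a r g k → a + r + (g + k) ≡ a + g + (r + k)
      lemma₁ = solve-∀
      lemma₂ : ∀ c z r k → c + z + (r + k) ≡ c + (r + k) + z
      lemma₂ = solve-∀
      lemma₃ : ∀ a r n z → a + r + n + z ≡ a + r + (z + n)
      lemma₃ = solve-∀

  length-σ : length σ ≡ i
  length-σ = trans (↭-length isPerm) (length-applyUpTo (1 +_) i)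

  columnsOf : List Column
  columnsOf = zip zeros (blocks norths σ)

  private
    length-zeros : length zeros ≡ length (blocks norths σ)
    length-zeros = trans (length-applyUpTo _ r) (sym (trans (length-blocks norths σ) length-norths))

    sum-norths≡length-σ : sum norths ≡ length σ
    sum-norths≡length-σ = trans sum-norths (sym length-σ)

  zeros≡ : map proj₁ columnsOf ≡ zeros
  zeros≡ = map-proj₁-zip zeros (blocks norths σ) length-zeros

  blocks≡ : map proj₂ columnsOf ≡ blocks norths σ
  blocks≡ = map-proj₂-zip zeros (blocks norths σ) length-zeros

  norths≡ : map (length ∘ proj₂) columnsOf ≡ norths
  norths≡ = begin
    map (length ∘ proj₂) columnsOf         ≡⟨ map-∘ columnsOf ⟩
    map length (map proj₂ columnsOf)       ≡⟨ cong (map length) blocks≡ ⟩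
    map length (blocks norths σ)           ≡⟨ map-length-blocks norths σ sum-norths≡length-σ ⟩
    norths                                 ∎
    where open ≡-Reasoning

  σ≡ : concat (map proj₂ columnsOf) ≡ σ
  σ≡ = trans (cong concat blocks≡) (concat-blocks norths σ sum-norths≡length-σ)

  length-columnsOf : length columnsOf ≡ r
  length-columnsOf = trans (sym (length-map proj₁ columnsOf))
    (trans (cong length zeros≡) (length-applyUpTo _ r))

  columnsOf-positive : All (All (0 <_) ∘ proj₂) columnsOf
  columnsOf-positive = All.map⁻ (subst (All (All (0 <_))) (sym blocks≡)
    (all-blocks norths (All-resp-↭ (↭-sym isPerm) (All.applyUpTo⁺₂ (1 +_) i λ _ → z<s))))

  private
    columnsOf-linked : All (Linked _≤_ ∘ proj₂) columnsOf
    columnsOf-linked = All.map⁻ (subst (All (Linked _≤_)) (sym blocks≡)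
      (All.map (Linked.map <⇒≤) (All.++⁻ˡ (blocks norths σ)
        (subst (All (Linked _<_))
          (trans (cong (λ ms → blocks ms σ) tail≡) (blocks-∷ʳ-0 norths σ)) increasing))))

    ballot : Ballot 0 columnsOf
    ballot zero    _  = z≤n
    ballot (suc k) k< = begin
      suc k                                                       ≤⟨ m≤n+m (suc k) _ ⟩
      multiplicity (2 + k , 3 + k) + suc k
        ≡⟨ rim-flow (≤-trans k< (≤-reflexive length-columnsOf)) ⟩
      sum (take (suc k) zeros) + sum (take (suc k) norths)
        ≡⟨ cong₂ (λ xs ys → sum (take (suc k) xs) + sum (take (suc k) ys))
                 zeros≡ norths≡ ⟨
      sum (take (suc k) (map proj₁ columnsOf)) + sum (take (suc k) (map (length ∘ proj₂) columnsOf))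
        ≡⟨ sum-take-height (suc k) columnsOf ⟨
      sum (take (suc k) (map height columnsOf))                   ∎
      where open ≤-Reasoning

    labelled : labels (path columnsOf) ↭ replicate (r ∸ i) 0 ++ [ 1 ⋯ i ]
    labelled = begin
      labels (path columnsOf)                                     ↭⟨ labels-path columnsOf ⟩
      replicate (sum (map proj₁ columnsOf)) 0 ++ concat (map proj₂ columnsOf)
        ≡⟨ cong₂ (λ n xs → replicate n 0 ++ xs) (trans (cong sum zeros≡)
             (trans (sym (m+n∸n≡m (sum zeros) i)) (cong (_∸ i) sum-zeros))) σ≡ ⟩
      replicate (r ∸ i) 0 ++ σ
        ↭⟨ ++⁺ˡ (replicate (r ∸ i) 0) isPerm ⟩
      replicate (r ∸ i) 0 ++ [ 1 ⋯ i ]                            ∎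
      where open PermutationReasoning

  toPath : MultiLabeledDyckPath r i
  toPath = record
    { word      = path columnsOf
    ; norths    = begin
        length (labels (path columnsOf))                  ≡⟨ ↭-length labelled ⟩
        length (replicate (r ∸ i) 0 ++ [ 1 ⋯ i ])         ≡⟨ length-++ (replicate (r ∸ i) 0) ⟩
        length (replicate (r ∸ i) 0) + length [ 1 ⋯ i ]
          ≡⟨ cong₂ _+_ (length-replicate (r ∸ i)) (length-applyUpTo (1 +_) i) ⟩
        r ∸ i + i
          ≡⟨ m∸n+n≡m (≤-trans (m≤n+m i _) (≤-reflexive sum-zeros)) ⟩
        r                                                 ∎
    ; easts     = trans (#E-path columnsOf) length-columnsOf
    ; aboveDiag = above-path⁺ columnsOf ballot
    ; labelled  = labelled
    ; nondecr   = linked-path columnsOf-linked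
    }
    where open ≡-Reasoning

open FromDiagram using (toPath)

toPath-cong : ∀ {r i} {u u′ : UnifiedDiagram r i} → u ≈ᵁ u′ →
              MultiLabeledDyckPath.word (toPath u) ≡ MultiLabeledDyckPath.word (toPath u′)
toPath-cong {r} eq = cong path (cong₂ zip
  (applyUpTo-cong r λ j j<r → D∼ (1 , 2 + j) (∈-Car↾⁺ (spoke (<⇒≤ j<r))))
  (cong₂ blocks (cong (take r ∘ toList ∘ tail) s≡) σ≡))
  where open _≈ᵁ_ eq

-- The columns give back the inner entries of `s`, the word `σ` and all spokes but the last. The
-- head of `s` comes from the level, its last entry and the last spoke vanish, and `rim-flow`
-- determines the rim.
toPath-injective : ∀ {r i} {u u′ : UnifiedDiagram r i} →
  MultiLabeledDyckPath.word (toPath u) ≡ MultiLabeledDyckPath.word (toPath u′) → u ≈ᵁ u′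
toPath-injective {r} {i} {u} {u′} eq = record
  { s≡ = s≡
  ; σ≡ = trans (sym F.σ≡) (trans (cong (concat ∘ map proj₂) columns≡) F′.σ≡)
  ; D∼ = λ e e∈ → multiplicity≡ (∈-Car↾⁻ e∈)
  }
  where
  module F  = FromDiagram u
  module F′ = FromDiagram u′
  module u  = UnifiedDiagram u
  module u′ = UnifiedDiagram u′
  open LineDotDiagram using (multiplicity)
  columns≡ : F.columnsOf ≡ F′.columnsOf
  columns≡ = path-injective F.columnsOf-positive F′.columnsOf-positive eq
  zeros≡ : F.zeros ≡ F′.zeros
  zeros≡ = trans (sym F.zeros≡) (trans (cong (map proj₁) columns≡) F′.zeros≡)
  norths≡ : F.norths ≡ F′.norths
  norths≡ = trans (sym F.norths≡) (trans (cong (map (length ∘ proj₂)) columns≡) F′.norths≡)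
  uncons : ∀ {n} (v : Vec ℕ (suc n)) → v ≡ head v ∷ tail v
  uncons (_ ∷ _) = refl
  s≡ : u.s ≡ u′.s
  s≡ = begin
    u.s                        ≡⟨ uncons u.s ⟩
    head u.s ∷ tail u.s        ≡⟨ cong₂ _∷_ (+-cancelʳ-≡ i _ _ (trans u.level (sym u′.level)))
           (toList-injective _ _ (trans F.tail≡ (trans (cong (_++ [ 0 ]) norths≡) (sym F′.tail≡)))) ⟩
    head u′.s ∷ tail u′.s      ≡⟨ uncons u′.s ⟨
    u′.s                       ∎
    where open ≡-Reasoning
  multiplicity≡ : ∀ {e} → CaracolEdge r e → multiplicity u.D e ≡ multiplicity u′.D e
  multiplicity≡ (spoke {j} j≤r) with m≤n⇒m<n∨m≡n j≤r
  ... | inj₁ j<r  = applyUpTo-injective r zeros≡ j j<r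
  ... | inj₂ refl = trans F.last-spoke (sym F′.last-spoke)
  multiplicity≡ (rim {k} k<r) = +-cancelʳ-≡ (suc k) _ _ (begin
    multiplicity u.D (2 + k , 3 + k) + suc k                    ≡⟨ F.rim-flow k<r ⟩
    sum (take (suc k) F.zeros) + sum (take (suc k) F.norths)
      ≡⟨ cong₂ (λ xs ys → sum (take (suc k) xs) + sum (take (suc k) ys)) zeros≡ norths≡ ⟩
    sum (take (suc k) F′.zeros) + sum (take (suc k) F′.norths)  ≡⟨ F′.rim-flow k<r ⟨
    multiplicity u′.D (2 + k , 3 + k) + suc k                   ∎)
    where open ≡-Reasoning

-- The inverse map

-- Cancelling the zeros is filtering out the positive labels.
positive-part : ∀ m n {xs ys} → All (0 <_) xs → All (0 <_) ys →
                replicate m 0 ++ xs ↭ replicate n 0 ++ ys → xs ↭ ys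
positive-part m n {xs} {ys} ps qs p = begin
  xs                                       ≡⟨ filter-pos m ps ⟨
  filter (0 <?_) (replicate m 0 ++ xs)     ↭⟨ filter-↭ (0 <?_) p ⟩
  filter (0 <?_) (replicate n 0 ++ ys)     ≡⟨ filter-pos n qs ⟩
  ys                                       ∎
  where
  open PermutationReasoning
  filter-pos : ∀ m {xs} → All (0 <_) xs → filter (0 <?_) (replicate m 0 ++ xs) ≡ xs
  filter-pos m {xs} ps = trans (filter-++ (0 <?_) (replicate m 0) xs)
    (cong₂ _++_ (filter-none (0 <?_) (All.replicate⁺ m λ ())) (filter-all (0 <?_) ps))

module ToDiagram {r i : ℕ} (cs : List Column) (length-cs : length cs ≡ r)
  (positive : All (All (0 <_) ∘ proj₂) cs) (linked : All (Linked _≤_ ∘ proj₂) cs)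
  (above : Above 0 (path cs)) (i≤r : i ≤ r)
  (labelled : labels (path cs) ↭ replicate (r ∸ i) 0 ++ [ 1 ⋯ i ]) where

  fs : List ℕ
  fs = map proj₁ cs

  bs : List (List ℕ)
  bs = map proj₂ cs

  ss : List ℕ
  ss = map length bs

  private
    length-fs : length fs ≡ r
    length-fs = trans (length-map proj₁ cs) length-cs

    length-ss : length ss ≡ r
    length-ss = trans (length-map length bs) (trans (length-map proj₂ cs) length-cs)

    blocks-perm : concat bs ↭ [ 1 ⋯ i ]
    blocks-perm = positive-part (sum fs) (r ∸ i) (All.concat⁺ (All.map⁺ positive))
      (All.applyUpTo⁺₂ (1 +_) i λ _ → z<s) (↭-trans (↭-sym (labels-path cs)) labelled)

    length-blocks≡i : length (concat bs) ≡ i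
    length-blocks≡i = trans (↭-length blocks-perm) (length-applyUpTo (1 +_) i)

    sum-ss : sum ss ≡ i
    sum-ss = trans (sum-map-length bs) length-blocks≡i

    sum-fs : sum fs + i ≡ r
    sum-fs = begin
      sum fs + i
        ≡⟨ cong₂ _+_ (length-replicate (sum fs)) length-blocks≡i ⟨
      length (replicate (sum fs) 0) + length (concat bs)  ≡⟨ length-++ (replicate (sum fs) 0) ⟨
      length (replicate (sum fs) 0 ++ concat bs)
        ≡⟨ ↭-length (↭-trans (↭-sym (labels-path cs)) labelled) ⟩
      length (replicate (r ∸ i) 0 ++ [ 1 ⋯ i ])           ≡⟨ length-++ (replicate (r ∸ i) 0) ⟩
      length (replicate (r ∸ i) 0) + length [ 1 ⋯ i ]
        ≡⟨ cong₂ _+_ (length-replicate (r ∸ i)) (length-applyUpTo (1 +_) i) ⟩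
      r ∸ i + i                                           ≡⟨ m∸n+n≡m i≤r ⟩
      r                                                   ∎
      where open ≡-Reasoning

    tailVec : ∃ λ (v : Vec ℕ (1 + r)) → toList v ≡ ss ++ [ 0 ]
    tailVec = vecOf (ss ++ [ 0 ])
      (trans (length-++ ss) (trans (+-comm (length ss) 1) (cong suc length-ss)))

    norths : Vec ℕ (1 + r)
    norths = proj₁ tailVec

    toList-norths : toList norths ≡ ss ++ [ 0 ]
    toList-norths = proj₂ tailVec

    -- The head must exceed the out-degree entry `r` by the number of lines leaving vertex 1, one
    -- for each zero.
    s : Vec ℕ (2 + r)
    s = sum fs + r ∷ norths

    level : sum fs + r + i ≡ r + r
    level = trans (swap (sum fs) r i) (cong (_+ r) sum-fs)
      where
      swap : ∀ a b c → a + b + c ≡ a + c + b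
      swap = solve-∀

    total : ∣ s ∣ᵥ ≡ r + r
    total = begin
      sum fs + r + sum (toList norths)     ≡⟨ cong (λ xs → sum fs + r + sum xs) toList-norths ⟩
      sum fs + r + sum (ss ++ [ 0 ])       ≡⟨ cong (sum fs + r +_) (sum-++ ss [ 0 ]) ⟩
      sum fs + r + (sum ss + 0)            ≡⟨ cong (sum fs + r +_) (trans (+-identityʳ _) sum-ss) ⟩
      sum fs + r + i                       ≡⟨ level ⟩
      r + r                                ∎
      where open ≡-Reasoning

    prefixSum-s : ∀ {k} → k ≤ r → prefixSum (suc k) s ≡ sum fs + r + sum (take k ss)
    prefixSum-s {k} k≤r = cong (sum fs + r +_) (cong sum (trans (cong (take k) toList-norths)
      (take-++-≤ k ss (≤-trans k≤r (≤-reflexive (sym length-ss))))))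

    -- The flow: the zeros of a column come from vertex 1, and the rim edges carry the excess of
    -- the height of the path over the diagonal.
    flow : Edge → ℕ
    flow (suc zero    , q) = nth fs (q ∸ 2)
    flow (suc (suc k) , _) = sum (take (suc k) fs) + sum (take (suc k) ss) ∸ suc k
    flow (zero        , _) = 0

    -- Deduplication yields the uniqueness that the multiplicity count requires, without comparing
    -- the families of edges of `Car`.
    edges lines : List Edge
    edges = deduplicate _≟ᴱ_ (Car↾ r)
    lines = concatMap (λ e → replicate (flow e) e) edges

    lines⊆Car↾ : All (_∈ Car↾ r) lines
    lines⊆Car↾ = All.map (∈-deduplicate⁻ _≟ᴱ_ (Car↾ r)) (concatMap-replicate-⊆ flow edges)

    lines⊆Car : All (CaracolEdge r) lines
    lines⊆Car = All.map ∈-Car↾⁻ lines⊆Car↾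

    multiplicity≡ : ∀ {e} → CaracolEdge r e → count (e ≟ᴱ_) lines ≡ flow e
    multiplicity≡ e∈ = count-concatMap-replicate _≟ᴱ_ flow (DecUnique.deduplicate-! _≟ᴱ_ (Car↾ r))
                         (∈-deduplicate⁺ _≟ᴱ_ (∈-Car↾⁺ e∈))

    spokes≡ : applyUpTo (spokes lines) r ≡ fs
    spokes≡ = trans (applyUpTo-cong r (λ j j<r → multiplicity≡ (spoke (<⇒≤ j<r))))
                    (nth-applyUpTo fs length-fs)

    count-1 : count (spans? 1) lines ≡ sum fs
    count-1 = begin
      count (spans? 1) lines               ≡⟨ count-spans-1 lines⊆Car ⟩
      sum (applyUpTo (spokes lines) (suc r))       ≡⟨ sum-applyUpTo-suc (spokes lines) r ⟩
      sum (applyUpTo (spokes lines) r) + spokes lines r  ≡⟨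
        cong₂ _+_ (cong sum spokes≡) (trans (multiplicity≡ (spoke ≤-refl))
                                            (nth-beyond fs (≤-reflexive length-fs))) ⟩
      sum fs + 0                           ≡⟨ +-identityʳ _ ⟩
      sum fs                               ∎
      where
      open ≡-Reasoning

    ballot : ∀ {k} → k ≤ r → k ≤ sum (take k fs) + sum (take k ss)
    ballot {k} k≤r = begin
      k
        ≤⟨ above-path⁻ cs above k (≤-trans k≤r (≤-reflexive (sym length-cs))) ⟩
      sum (take k (map height cs))
        ≡⟨ sum-take-height k cs ⟩
      sum (take k fs) + sum (take k (map (length ∘ proj₂) cs))
        ≡⟨ cong (λ xs → sum (take k fs) + sum (take k xs)) (map-∘ cs) ⟩
      sum (take k fs) + sum (take k ss)                                     ∎
      where open ≤-Reasoning

    column-eq : ∀ {k} → k ≤ r →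
                count (spans? (suc k)) lines + (r + k) ≡ sum fs + r + sum (take k ss)
    column-eq {zero}  _   = trans (cong₂ _+_ count-1 (+-identityʳ r)) (sym (+-identityʳ _))
    column-eq {suc k} k<r = +-cancelʳ-≡ F _ _ (begin
      C + (r + suc k) + F            ≡⟨ lemma₁ C r (suc k) F ⟩
      C + F + suc k + r              ≡⟨ cong (λ x → x + suc k + r) (begin
        C + F
          ≡⟨ cong (λ xs → C + sum (take (suc k) xs)) spokes≡ ⟨
        C + sum (take (suc k) (applyUpTo (spokes lines) r))       ≡⟨ count-spans-2+ lines⊆Car k<r ⟩
        count (spans? 1) lines + count ((2 + k , 3 + k) ≟ᴱ_) lines
          ≡⟨ cong₂ _+_ count-1 (multiplicity≡ (rim k<r)) ⟩
        sum fs + (F + S ∸ suc k)                          ∎) ⟩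
      sum fs + (F + S ∸ suc k) + suc k + r   ≡⟨ cong (_+ r) (+-assoc (sum fs) _ (suc k)) ⟩
      -- The path lies above the diagonal, so the truncated subtraction in `flow` is exact.
      sum fs + (F + S ∸ suc k + suc k) + r   ≡⟨ cong (λ x → sum fs + x + r) (m∸n+n≡m (ballot k<r)) ⟩
      sum fs + (F + S) + r                   ≡⟨ lemma₂ (sum fs) F S r ⟩
      sum fs + r + S + F                     ∎)
      where
      open ≡-Reasoning
      C = count (spans? (2 + k)) lines
      F = sum (take (suc k) fs)
      S = sum (take (suc k) ss)
      lemma₁ : ∀ c r k f → c + (r + k) + f ≡ c + f + k + r
      lemma₁ = solve-∀
      lemma₂ : ∀ a f s r → a + (f + s) + r ≡ a + r + s + f
      lemma₂ = solve-∀

    prefixSum-eq : ∀ {k} → k ≤ r →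
      count (spans? (suc k)) lines + prefixSum (suc k) (𝐭 r) ≡ prefixSum (suc k) s
    prefixSum-eq {k} k≤r = begin
      count (spans? (suc k)) lines + prefixSum (suc k) (𝐭 r)
        ≡⟨ cong (count (spans? (suc k)) lines +_) (prefixSum-𝐭 k≤r) ⟩
      count (spans? (suc k)) lines + (r + k)                   ≡⟨ column-eq k≤r ⟩
      sum fs + r + sum (take k ss)                             ≡⟨ prefixSum-s k≤r ⟨
      prefixSum (suc k) s                                      ∎
      where open ≡-Reasoning

    -- Up to `suc r`, the difference of the prefix sums is a number of lines crossing a column; at
    -- `2 + r` both are the full total.
    dominates : ∀ k → k ≤ 2 + r → prefixSum k (𝐭 r) ≤ prefixSum k s
    dominates zero    _        = z≤n
    dominates (suc k) (s≤s k≤) with m≤n⇒m<n∨m≡n k≤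
    ... | inj₁ (s≤s k≤r) = ≤-trans (m≤n+m _ (count (spans? (suc k)) lines))
                                   (≤-reflexive (prefixSum-eq k≤r))
    ... | inj₂ refl      = ≤-reflexive (trans (prefixSum-all (𝐭 r)) (trans (∣𝐭∣ r)
                             (sym (trans (prefixSum-all s) total))))

    unique-blocks : All Unique bs
    unique-blocks = unique-concat (Permutationₛ.Unique-resp-↭ (setoid ℕ) (↭⇒↭ₛ (↭-sym blocks-perm))
      (Unique.applyUpTo⁺₁ (1 +_) i λ a<b _ → <⇒≢ (s<s a<b)))

    -- The labels of a block are distinct, which turns weak increase into strict increase; the last
    -- entry of `s` contributes the empty block.
    increasing : All (Linked _<_) (blocks (toList norths) (concat bs))
    increasing = subst (All (Linked _<_))
      (sym (trans (cong (λ ms → blocks ms (concat bs)) toList-norths)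
             (trans (blocks-∷ʳ-0 ss (concat bs)) (cong (_++ [ [] ]) (blocks-concat bs)))))
      (All.++⁺ (All.zipWith (λ (u , l) → ≤-linked⇒<-linked u l) (unique-blocks , All.map⁺ linked))
               ([] ∷ []))

  diagram : UnifiedDiagram r i
  diagram = record
    { s          = s
    ; isDyck     = record { total = trans total (sym (∣𝐭∣ r)) ; dominates = dominates }
    ; level      = trans level (sym (∣𝐭∣ r))
    ; σ          = concat bs
    ; isPerm     = blocks-perm
    ; increasing = increasing
    ; D          = fromLines lines lines⊆Car↾ λ k →
        trans (+≡⇒+≡⊖ {b = prefixSum (column k) (𝐭 r)} (prefixSum-eq (s≤s⁻¹ (Fin.toℕ<n k))))
              (sym (coefficient-⊟ s (𝐭 r) (column k)))
    }

  toPath-diagram : MultiLabeledDyckPath.word (toPath diagram) ≡ path cs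
  toPath-diagram = cong path (begin
    zip (applyUpTo (spokes lines) r) (blocks (take r (toList norths)) (concat bs))
      ≡⟨ cong₂ zip spokes≡ (trans (cong (λ ms → blocks ms (concat bs)) (begin
           take r (toList norths)     ≡⟨ cong (take r) toList-norths ⟩
           take r (ss ++ [ 0 ])       ≡⟨ take-++-≤ r ss (≤-reflexive (sym length-ss)) ⟩
           take r ss                  ≡⟨ take-all r ss (≤-reflexive length-ss) ⟩
           ss                         ∎)) (blocks-concat bs)) ⟩
    zip fs bs                     ≡⟨ zip-proj cs ⟩
    cs                            ∎)
    where open ≡-Reasoning

toPath-surjective : ∀ {r i} → i ≤ r → (M : MultiLabeledDyckPath r i) →
  ∃ λ (u : UnifiedDiagram r i) → MultiLabeledDyckPath.word (toPath u) ≡ MultiLabeledDyckPath.word M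
toPath-surjective {r} i≤r record
  { word = w ; norths = n ; easts = e ; aboveDiag = a ; labelled = l ; nondecr = p }
  with columns w p (above⇒suffix w a (trans n (sym e)))
... | cs , refl , positive , linked = T.diagram , T.toPath-diagram
  where
  module T = ToDiagram cs (trans (sym (#E-path cs)) e) positive linked a i≤r l

toPath-bijection : ∀ r i → i ≤ r → Bijection (𝒰 r i) (ℳ r i)
toPath-bijection r i i≤r = record
  { to        = toPath
  ; cong      = toPath-cong
  ; bijective = toPath-injective
              , strictlySurjective⇒surjective (𝒰 r i) (ℳ r i) {f = toPath} toPath-cong
                  (toPath-surjective i≤r)
  }

-- Finiteness

module _ {A : Set} (_≟ᴬ_ : DecidableEquality A) where
  open DecMembership _≟ᴬ_ using (_∈?_)

  ↭-dec : (xs ys : List A) → Dec (xs ↭ ys)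
  ↭-dec []       []       = yes ↭-refl
  ↭-dec []       (y ∷ ys) = no λ p → contradiction (↭-length p) λ ()
  ↭-dec (x ∷ xs) ys with x ∈? ys
  ... | no x∉ys = no λ p → x∉ys (∈-resp-↭ p (here refl))
  ... | yes x∈ys with ∈-∃++ x∈ys
  ... | as , bs , refl = map′ (λ p → ↭-trans (prep x p) (↭-sym (shift x as bs)))
                              (drop-mid [] as) (↭-dec xs (as ++ bs))

  -- Classes of `X` correspond to values of `f`. Listing these values without repetition, the
  -- position of `f x` is the bijection.
  hasCardinality : {X : Set} (f : X → A) → Decidable (λ a → ∃ λ x → f x ≡ a) →
                   (xs : List A) → (∀ x → f x ∈ xs) →
                   ∃ (HasCardinality (On.setoid (setoid A) f))
  hasCardinality {X} f image? xs f∈xs = length image , record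
    { to        = position
    ; cong      = cong-position
    ; bijective = (λ {x} {y} eq → trans (lookup-position x)
                     (trans (cong (lookup image) eq) (sym (lookup-position y))))
                , strictlySurjective⇒surjective (On.setoid (setoid A) f) (setoid _)
                    (λ {x} {y} → cong-position {x} {y}) preimage
    }
    where
    image = deduplicate _≟ᴬ_ (filter image? xs)
    ∈-image : ∀ x → f x ∈ image
    ∈-image x = ∈-deduplicate⁺ _≟ᴬ_ (∈-filter⁺ image? (f∈xs x) (x , refl))
    position = index ∘ ∈-image
    lookup-position : ∀ x → f x ≡ lookup image (position x)
    lookup-position x = lookup-index (∈-image x)
    unique = lookup-injective (DecUnique.deduplicate-! _≟ᴬ_ (filter image? xs))
    cong-position : ∀ {x y} → f x ≡ f y → position x ≡ position y
    cong-position {x} {y} eq = unique _ _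
      (trans (sym (lookup-position x)) (trans eq (lookup-position y)))
    preimage : ∀ k → ∃ λ x → position x ≡ k
    preimage k
      with proj₂ (∈-filter⁻ image? {xs = xs} (∈-deduplicate⁻ _≟ᴬ_ _ (∈-lookup {xs = image} k)))
    ... | x , eq = x , unique _ _ (trans (sym (lookup-position x)) eq)

_≟ˢ_ : DecidableEquality Step
N a ≟ˢ N b = map′ (cong N) N-injective (a ≟ b)
N a ≟ˢ E   = no λ ()
E   ≟ˢ N b = no λ ()
E   ≟ˢ E   = yes refl

_⊑?_ : ∀ x y → Dec (x ⊑ y)
N a ⊑? N b = map′ NN (λ { (NN a≤b) → a≤b }) (a ≤? b)
N a ⊑? E   = yes -E
E   ⊑? y   = yes E-

wordsOver : {A : Set} → List A → ℕ → List (List A)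
wordsOver as zero    = [ [] ]
wordsOver as (suc n) = cartesianProductWith _∷_ as (wordsOver as n)

∈-wordsOver : {A : Set} {as w : List A} → All (_∈ as) w → w ∈ wordsOver as (length w)
∈-wordsOver []       = here refl
∈-wordsOver (a∈ ∷ w∈) = ∈-cartesianProductWith⁺ _∷_ a∈ (∈-wordsOver w∈)

length-word : ∀ w → length w ≡ #N w + #E w
length-word []        = refl
length-word (N _ ∷ w) = cong suc (length-word w)
length-word (E   ∷ w) = trans (cong suc (length-word w)) (sym (+-suc (#N w) (#E w)))

alphabet : ℕ → List Step
alphabet i = E ∷ map N (applyUpTo (λ a → a) (suc i))

∈-alphabet : ∀ {i} w → All (_≤ i) (labels w) → All (_∈ alphabet i) w
∈-alphabet []        _        = []
∈-alphabet (N a ∷ w) (a≤i ∷ p) =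
  there (∈-map⁺ N (∈-applyUpTo⁺ (λ a → a) (s≤s a≤i))) ∷ ∈-alphabet w p
∈-alphabet (E ∷ w)   p        = here refl ∷ ∈-alphabet w p

-- A path is a word of `r + r` letters over `E` and `N 0` up to `N i`, and each of its defining
-- conditions is decidable.
ℳ-finite : ∀ r i → ∃ (HasCardinality (ℳ r i))
ℳ-finite r i =
  hasCardinality (List-≡-dec _≟ˢ_) MultiLabeledDyckPath.word image? (wordsOver (alphabet i) (r + r)) word∈
  where
  image? : Decidable (λ w → ∃ λ (M : MultiLabeledDyckPath r i) → MultiLabeledDyckPath.word M ≡ w)
  image? w = map′
    (λ (n , e , a , l , p) → record
      { word = w ; norths = n ; easts = e ; aboveDiag = a ; labelled = l ; nondecr = p } , refl)
    (λ { (M , refl) → let open MultiLabeledDyckPath M in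
         norths , easts , aboveDiag , labelled , nondecr })
    ((#N w ≟ r) ×-dec (#E w ≟ r) ×-dec above? 0 w ×-dec
     ↭-dec _≟_ (labels w) _ ×-dec Linked.linked? _⊑?_ w)
  word∈ : ∀ (M : MultiLabeledDyckPath r i) →
          MultiLabeledDyckPath.word M ∈ wordsOver (alphabet i) (r + r)
  word∈ M = subst (λ n → word ∈ wordsOver (alphabet i) n)
    (trans (length-word word) (cong₂ _+_ norths easts))
    (∈-wordsOver (∈-alphabet word (All-resp-↭ (↭-sym labelled)
      (All.++⁺ (All.replicate⁺ (r ∸ i) z≤n) (All.applyUpTo⁺₁ (1 +_) i λ a<i → a<i)))))
    where open MultiLabeledDyckPath M

theorem5p6 : (r i : ℕ) → i ≤ r →
    Bijection (𝒰 r i) (ℳ r i) ×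
    ∃ λ T → HasCardinality (𝒰 r i) T × HasCardinality (ℳ r i) T
theorem5p6 r i i≤r =
  -- Counting takes place on the side of the paths, where equality is decidable equality of words,
  -- and is carried back along `Φ`.
  let Φ = toPath-bijection r i i≤r ; (T , ℳ↔Fin) = ℳ-finite r i in
  Φ , T , Composition.bijection Φ ℳ↔Fin , ℳ↔Fin
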